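{- For $j\in\{1,2\}$ let $x_j=e^{z_j}$ and $u_j=e^{v_j}$. Then $$\mathrm{Coeff}_{y^0}\left(\frac{(x_1x_2y)_\infty(y)_\infty}{(x_1y)_\infty(x_2y)_\infty}\cdot\frac{(u_1u_2y^{ -1}q)_\infty(y^{ -1}q)_\infty}{(u_1y^{ -1}q)_\infty(u_2y^{ -1}q)_\infty}\right)\in{\rm q}\mathcal{BD}[[z_1,z_2,v_1,v_2]].$$ More precisely, for all $m,n,\tilde m,\tilde n\ge0$, the coefficient of $z_1^mz_2^nv_1^{\tilde m}v_2^{\tilde n}$ in this expression is a finite $\mathbb{Q}$-linear combination of bi-brackets in ${\rm q}\mathcal{BD}$ of weights at most $m+n+\tilde m+\tilde n$.
   Context: $q,y$ are formal variables, $(a)_\infty=(a;q)_\infty=\prod_{n\ge0}(1-aq^n)$, and the product above is expanded as an element of $\mathbb{Q}[[q,y,y^{ -1},z_1,z_2,v_1,v_2]]$; $\mathrm{Coeff}_{y^0}$ denotes the coefficient of $y^0$. For integers $\ell\ge0$, $s_1,\dots,s_\ell\ge1$, $r_1,\dots,r_\ell\ge0$, the bi-bracket is $$\begin{bmatrix} s_1,\dots,s_\ell\\ r_1,\dots,r_\ell\end{bmatrix}=\sum_{\substack{u_1>\cdots>u_\ell>0\\ v_1,\dots,v_\ell>0}}\frac{u_1^{r_1}\cdots u_\ell^{r_\ell}}{r_1!\cdots r_\ell!}\cdot\frac{v_1^{s_1-1}\cdots v_\ell^{s_\ell-1}}{(s_1-1)!\cdots(s_\ell-1)!}\,q^{u_1v_1+\cdots+u_\ell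 v_\ell}\in\mathbb{Q}[[q]],$$ of weight $\sum_{i=1}^\ell(s_i+r_i)$ (the empty bi-bracket equals $1$). ${\rm q}\mathcal{BD}$ is the $\mathbb{Q}$-span of all bi-brackets with $\ell=0$ or $s_1>1$. -}

module Defs where

open import Data.Nat as ℕ using (ℕ; zero; suc; _∸_; _≤_; _<_; _!; _≤ᵇ_)
open import Data.Nat.Properties using (_!≢0)
open import Data.Integer using (+_)
open import Data.Rational using (ℚ; 0ℚ; 1ℚ; _+_; _*_; _-_; _/_)
open import Data.Bool using (if_then_else_)
open import Data.Product using (_×_; _,_)
open import Data.List using (List; []; _∷_)

Σ≤ : ℕ → (ℕ → ℚ) → ℚ
Σ≤ zero    f = f 0
Σ≤ (suc n) f = Σ≤ n f + f (suc n)

ℕ→ℚ : ℕ → ℚ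
ℕ→ℚ n = (+ n) / 1

inv! : ℕ → ℚ
inv! n = ((+ 1) / (n !)) {{n !≢0}}

δ : ℕ → ℕ → ℚ
δ m n = if (m ≤ᵇ n) Data.Bool.∧ (n ≤ᵇ m) then 1ℚ else 0ℚ
  where import Data.Bool

-- Formal power series in ℚ[[q, t, z₁, z₂]] as coefficient functions:
--   f k a b c  = coefficient of  q^k t^a z₁^b z₂^c .

PS : Set
PS = ℕ → ℕ → ℕ → ℕ → ℚ

oneS : PS
oneS k a b c = δ k 0 * (δ a 0 * (δ b 0 * δ c 0))

_⊖_ : PS → PS → PS
(f ⊖ g) k a b c = f k a b c - g k a b c

_⊛_ : PS → PS → PS
(f ⊛ g) k a b c =
  Σ≤ k λ i → Σ≤ a λ j → Σ≤ b λ l → Σ≤ c λ m →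
    f i j l m * g (k ∸ i) (a ∸ j) (b ∸ l) (c ∸ m)

infixl 7 _⊛_
infixl 6 _⊖_

powS : PS → ℕ → PS
powS s zero    = oneS
powS s (suc n) = powS s n ⊛ s

qPow : ℕ → PS
qPow n k a b c = δ k n * (δ a 0 * (δ b 0 * δ c 0))

tVar : PS
tVar k a b c = δ k 0 * (δ a 1 * (δ b 0 * δ c 0))

expZ₁ : PS
expZ₁ k a b c = δ k 0 * (δ a 0 * (inv! b * δ c 0))

expZ₂ : PS
expZ₂ k a b c = δ k 0 * (δ a 0 * (δ b 0 * inv! c))

-- geometric series 1/(1 - s) = Σ_j s^j, for s WITH ZERO CONSTANT TERM;
-- then s^j contributes to total degree ≥ j only, so the sum is finite
-- at each coefficient.
geomS : PS → PS
geomS s k a b c = Σ≤ (k ℕ.+ a ℕ.+ b ℕ.+ c) λ j → powS s j k a b c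

prodTo : (ℕ → PS) → ℕ → PS
prodTo g zero    = g 0
prodTo g (suc n) = prodTo g n ⊛ g (suc n)

-- q-adic infinite product  ∏_{n ≥ 0} g n, for factors with g n ≡ 1 mod q^n
-- (n ≥ 1): the coefficient of q^k only depends on the factors n ≤ k.
infProd : (ℕ → PS) → PS
infProd g k a b c = prodTo g k k a b c

qPoch : PS → PS
qPoch a = infProd λ n → oneS ⊖ a ⊛ qPow n

-- 1 / (a ; q)_∞ = ∏_{n≥0} 1/(1 - a q^n)   (a with zero constant term)
qPochInv : PS → PS
qPochInv a = infProd λ n → geomS (a ⊛ qPow n)

Fser : PS
Fser = qPoch (expZ₁ ⊛ expZ₂ ⊛ tVar) ⊛ qPoch tVar
     ⊛ qPochInv (expZ₁ ⊛ tVar) ⊛ qPochInv (expZ₂ ⊛ tVar)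

-- The full product of the theorem is  F(q, y; z₁, z₂) · F(q, y⁻¹q; v₁, v₂).
-- Writing F(q,t;v) = Σ b_{k,j} q^k t^j and substituting t = y⁻¹ q gives
-- Σ b_{k,j} q^{k+j} y^{-j}; hence the coefficient of
-- q^K y^0 z₁^m z₂^n v₁^m' v₂^n' of the product is:
coeffY0 : ℕ → ℕ → ℕ → ℕ → ℕ → ℚ
coeffY0 K m n m' n' =
  Σ≤ K λ j → Σ≤ (K ∸ j) λ k₁ →
    Fser k₁ j m n * Fser (K ∸ j ∸ k₁) j m' n'

-- Bi-brackets.  An index is a list of pairs (s_i , r_i), i = 1..ℓ.

BiIdx : Set
BiIdx = List (ℕ × ℕ)

ValidBi : BiIdx → Set
ValidBi []            = Data.Unit.⊤
  where import Data.Unit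
ValidBi ((s , r) ∷ L) = (1 ≤ s) × ValidBi L

InQBD : BiIdx → Set
InQBD []            = Data.Unit.⊤
  where import Data.Unit
InQBD ((s , r) ∷ L) = 1 < s

weight : BiIdx → ℕ
weight []            = 0
weight ((s , r) ∷ L) = s ℕ.+ r ℕ.+ weight L

-- bbCoeff L N B = coefficient of q^N in
--   Σ_{B > u₁ > ... > u_ℓ > 0, v_i > 0}  Π u_i^{r_i}/r_i! · v_i^{s_i-1}/(s_i-1)! · q^{Σ u_i v_i}
-- (terms with u_i v_i summing beyond N are excluded; u, v ≥ 1 force u, v ≤ N)
bbCoeff : BiIdx → ℕ → ℕ → ℚ
bbCoeff []            N B = δ N 0
bbCoeff ((s , r) ∷ L) N B =
  Σ≤ B λ u → Σ≤ N λ v →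
    if (1 ≤ᵇ u) ∧ (suc u ≤ᵇ B) ∧ (1 ≤ᵇ v) ∧ (u ℕ.* v ≤ᵇ N)
    then (ℕ→ℚ (u ℕ.^ r) * inv! r) * (ℕ→ℚ (v ℕ.^ (s ∸ 1)) * inv! (s ∸ 1))
         * bbCoeff L (N ∸ u ℕ.* v) u
    else 0ℚ
  where open import Data.Bool using (_∧_)

-- coefficient of q^N in the bi-bracket [s ; r]  (u₁ ≤ N suffices)
bibracket : BiIdx → ℕ → ℚ
bibracket L N = bbCoeff L N (suc N)

linComb : List (ℚ × BiIdx) → ℕ → ℚ
linComb []             N = 0ℚ
linComb ((c , L) ∷ cs) N = c * bibracket L N + linComb cs N

{-# OPTIONS --safe #-}
-- Write F(t) = Π_{n≥0} G(tqⁿ) with G(t) = 1 + Σ_{D≥1} g_D t^D.  The coefficients of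
-- g_D = -(1 - x₁)(1 - x₂) Σ_{i<D} x₁ⁱ x₂^{D-1-i} at z₁ᵇz₂ᶜ are polynomials in D, without constant term
-- and of degree < b + c, so the coefficients of F are combinations of sums over n₁ > ⋯ > n_k ≥ 0 and
-- D₁, …, D_k ≥ 1 of Π D_i^{α_i} t^{D_i} q^{n_i D_i}.  The coefficient of y⁰ pairs two such sums,
-- (n_i, D_i) and (m_j, E_j) with m_j ≥ 1, under the constraint ΣD_i = ΣE_j.  Cut an interval of that
-- length into consecutive pieces of lengths D_i, and also into pieces of lengths E_j: on the common
-- refinement with lengths f_r the exponent of q becomes Σ f_r h_r, where the h_r = n_i + m_j are strictly
-- decreasing.  The numbers of (n, m) with given h are polynomials in h, and so the pairing is a
-- combination of bi-brackets with u_r = h_r and v_r = f_r.  As α₁, β₁ ≥ 1, the summand is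
-- divisible by v₁ = f₁ = min(D₁, E₁), which gives s₁ > 1.
module Submission where

open import Defs
open import Algebra using (CommutativeRing)
open import Data.Bool using (true; false; if_then_else_; _∧_)
open import Data.Integer as ℤ using (+_)
import Data.Integer.Properties as ℤ
open import Data.List using (List; []; _∷_; _++_)
open import Data.List.Relation.Unary.All as All using (All; []; _∷_)
import Data.List.Relation.Unary.All.Properties as All
open import Data.Nat as ℕ using (ℕ; zero; suc; _∸_; _<_; _≤_; s≤s; z≤n; _!; _≤ᵇ_)
import Data.Nat.Properties as ℕ
open import Data.Nat.Tactic.RingSolver using (solve-∀)
open import Data.Product using (Σ; _×_; _,_; proj₁; proj₂)
open import Data.Rational as ℚ using (ℚ; 0ℚ; 1ℚ)
import Data.Rational.Properties as ℚ
import Data.Rational.Unnormalised as ℚᵘ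
import Data.Rational.Unnormalised.Properties as ℚᵘ
open import Data.Unit using (⊤; tt)
open import Function using (_∘_)
open import Level using (0ℓ)
open import Relation.Binary.PropositionalEquality as ≡ using (_≡_)
open import Relation.Nullary using (yes; no; contradiction)

-- The pairing is computed by recursion on the leading blocks. With leading levels `n + m = g`
-- fixed, a common piece of length min(D, E) is cut off; its power of q depends on `g` alone, since
-- q^n q^(m+1) = q^(g+1). If D < E, the rest of the E-block stays at level m with an exponent of its
-- own and only n goes down: a single sum over smaller `g`. If D = E, both levels go down and the
-- sum is twofold, which costs one factor u; the extra unit of weight is paid for by the merging of
-- two blocks into one variable v. The induction therefore carries arbitrary exponents and an
-- explicit weight bound. The bound closes because a block of exponent α uses up at least α + 1 of
-- the degree in z₁ and z₂, its share s = α + 1 of the weight.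
--
-- All this holds over any ring with a map from ℚ and an element q, as identities between functions
-- of (g, j) with constant coefficients. Infinite products and unbounded levels enter by truncation:
-- the coefficient of q^K sees levels up to K, so the bound moves with the coefficient that is read
-- off.

Ring : Set₁
Ring = CommutativeRing 0ℓ 0ℓ

-- Finite sums, Cauchy products and rings of formal power series.

module FiniteSums (R : Ring) where
  open CommutativeRing R public hiding (zero)
  open import Algebra.Properties.Ring ring public using (-‿distribˡ-*; -0#≈0#)
  open import Relation.Binary.Reasoning.Setoid setoid public
  open import Algebra.Solver.Ring.NaturalCoefficients.Default commutativeSemiring public
    using (solve; _:=_; _:+_; _:*_)

  Σ< : ℕ → (ℕ → Carrier) → Carrier
  Σ< zero    f = 0#
  Σ< (suc n) f = f 0 + Σ< n (f ∘ suc)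

  Σ<-cong< : ∀ n {f g} → (∀ i → i < n → f i ≈ g i) → Σ< n f ≈ Σ< n g
  Σ<-cong< zero    h = refl
  Σ<-cong< (suc n) h = +-cong (h 0 (s≤s z≤n)) (Σ<-cong< n (λ i i<n → h (suc i) (s≤s i<n)))

  Σ<-cong : ∀ n {f g} → (∀ i → f i ≈ g i) → Σ< n f ≈ Σ< n g
  Σ<-cong n h = Σ<-cong< n (λ i _ → h i)

  Σ<-last : ∀ n f → Σ< (suc n) f ≈ Σ< n f + f n
  Σ<-last zero    f = +-comm _ _
  Σ<-last (suc n) f = trans (+-congˡ (Σ<-last n (f ∘ suc))) (sym (+-assoc _ _ _))

  Σ<-0 : ∀ n → Σ< n (λ _ → 0#) ≈ 0#
  Σ<-0 zero    = refl
  Σ<-0 (suc n) = trans (+-identityˡ _) (Σ<-0 n)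

  Σ<-zero : ∀ n {f} → (∀ i → i < n → f i ≈ 0#) → Σ< n f ≈ 0#
  Σ<-zero n h = trans (Σ<-cong< n h) (Σ<-0 n)

  Σ<-+ : ∀ n f g → Σ< n (λ i → f i + g i) ≈ Σ< n f + Σ< n g
  Σ<-+ zero    f g = sym (+-identityˡ _)
  Σ<-+ (suc n) f g = trans (+-congˡ (Σ<-+ n (f ∘ suc) (g ∘ suc)))
    (solve 4 (λ a b c d → (a :+ b) :+ (c :+ d) := (a :+ c) :+ (b :+ d)) refl _ _ _ _)

  Σ<-*ˡ : ∀ n a f → Σ< n (λ i → a * f i) ≈ a * Σ< n f
  Σ<-*ˡ zero    a f = sym (zeroʳ a)
  Σ<-*ˡ (suc n) a f = trans (+-congˡ (Σ<-*ˡ n a (f ∘ suc))) (sym (distribˡ _ _ _))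

  Σ<-*ʳ : ∀ n a f → Σ< n (λ i → f i * a) ≈ Σ< n f * a
  Σ<-*ʳ n a f = trans (Σ<-cong n (λ i → *-comm (f i) a)) (trans (Σ<-*ˡ n a f) (*-comm _ _))

  Σ<-swap : ∀ m n (f : ℕ → ℕ → Carrier) →
            Σ< m (λ i → Σ< n (f i)) ≈ Σ< n (λ j → Σ< m (λ i → f i j))
  Σ<-swap zero    n f = sym (Σ<-0 n)
  Σ<-swap (suc m) n f = trans (+-congˡ (Σ<-swap m n (f ∘ suc))) (sym (Σ<-+ n _ _))

  Σ<-extend : ∀ {m n} f → m ℕ.≤ n → (∀ i → m ℕ.≤ i → f i ≈ 0#) → Σ< n f ≈ Σ< m f
  Σ<-extend {n = n} f z≤n h = Σ<-zero n (λ i _ → h i z≤n)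
  Σ<-extend f (s≤s m≤n) h = +-congˡ (Σ<-extend (f ∘ suc) m≤n (λ i m≤i → h (suc i) (s≤s m≤i)))

  -- Shifting `f` takes the place of the difference `n ∸ i`, so that the ring laws follow by
  -- structural induction; `conv-Σ<` recovers the usual form.
  conv : (ℕ → Carrier) → (ℕ → Carrier) → ℕ → Carrier
  conv f g zero    = f 0 * g 0
  conv f g (suc n) = f 0 * g (suc n) + conv (f ∘ suc) g n

  conv-cong : ∀ {f f′ g g′} → (∀ i → f i ≈ f′ i) → (∀ i → g i ≈ g′ i) →
              ∀ n → conv f g n ≈ conv f′ g′ n
  conv-cong p r zero    = *-cong (p 0) (r 0)
  conv-cong p r (suc n) = +-cong (*-cong (p 0) (r (suc n))) (conv-cong (p ∘ suc) r n)

  conv-Σ< : ∀ f g n → conv f g n ≈ Σ< (suc n) (λ i → f i * g (n ∸ i))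
  conv-Σ< f g zero    = sym (+-identityʳ _)
  conv-Σ< f g (suc n) = +-congˡ (conv-Σ< (f ∘ suc) g n)

  conv-zeroˡ : ∀ {f} g → (∀ i → f i ≈ 0#) → ∀ n → conv f g n ≈ 0#
  conv-zeroˡ g h zero    = trans (*-congʳ (h 0)) (zeroˡ _)
  conv-zeroˡ g h (suc n) =
    trans (+-cong (trans (*-congʳ (h 0)) (zeroˡ _)) (conv-zeroˡ g (h ∘ suc) n)) (+-identityˡ _)

  conv-distribʳ : ∀ f f′ g n → conv (λ i → f i + f′ i) g n ≈ conv f g n + conv f′ g n
  conv-distribʳ f f′ g zero    = distribʳ _ _ _
  conv-distribʳ f f′ g (suc n) =
    trans (+-cong (distribʳ _ _ _) (conv-distribʳ (f ∘ suc) (f′ ∘ suc) g n))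
      (solve 4 (λ a b c d → (a :+ b) :+ (c :+ d) := (a :+ c) :+ (b :+ d)) refl _ _ _ _)

  conv-*ˡ : ∀ a f g n → conv (λ i → a * f i) g n ≈ a * conv f g n
  conv-*ˡ a f g zero    = *-assoc _ _ _
  conv-*ˡ a f g (suc n) =
    trans (+-cong (*-assoc _ _ _) (conv-*ˡ a (f ∘ suc) g n)) (sym (distribˡ _ _ _))

  conv-sucʳ : ∀ f g n → conv f g (suc n) ≈ conv f (g ∘ suc) n + f (suc n) * g 0
  conv-sucʳ f g zero    = refl
  conv-sucʳ f g (suc n) =
    trans (+-congˡ (conv-sucʳ (f ∘ suc) g n)) (sym (+-assoc _ _ _))

  conv-comm : ∀ f g n → conv f g n ≈ conv g f n
  conv-comm f g zero    = *-comm _ _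
  conv-comm f g (suc n) = begin
    f 0 * g (suc n) + conv (f ∘ suc) g n ≈⟨ +-cong (*-comm _ _) (conv-comm (f ∘ suc) g n) ⟩
    g (suc n) * f 0 + conv g (f ∘ suc) n ≈⟨ +-comm _ _ ⟩
    conv g (f ∘ suc) n + g (suc n) * f 0 ≈⟨ conv-sucʳ g f n ⟨
    conv g f (suc n)                     ∎

  conv-assoc : ∀ f g h n → conv (conv f g) h n ≈ conv f (conv g h) n
  conv-assoc f g h zero    = *-assoc _ _ _
  conv-assoc f g h (suc n) = begin
    (f 0 * g 0) * h (suc n) + conv (λ i → f 0 * g (suc i) + conv (f ∘ suc) g i) h n
      ≈⟨ +-congˡ (conv-distribʳ _ _ h n) ⟩
    (f 0 * g 0) * h (suc n) + (conv (λ i → f 0 * g (suc i)) h n + conv (conv (f ∘ suc) g) h n)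
      ≈⟨ +-congˡ (+-cong (conv-*ˡ (f 0) (g ∘ suc) h n) (conv-assoc (f ∘ suc) g h n)) ⟩
    (f 0 * g 0) * h (suc n) + (f 0 * conv (g ∘ suc) h n + conv (f ∘ suc) (conv g h) n)
      ≈⟨ solve 5 (λ a b c d e → (a :* b) :* c :+ (a :* d :+ e) := a :* (b :* c :+ d) :+ e) refl _ _ _ _ _ ⟩
    f 0 * (g 0 * h (suc n) + conv (g ∘ suc) h n) + conv (f ∘ suc) (conv g h) n ∎

  const : Carrier → ℕ → Carrier
  const a zero    = a
  const a (suc _) = 0#

  conv-const : ∀ a f n → conv (const a) f n ≈ a * f n
  conv-const a f zero    = refl
  conv-const a f (suc n) = trans (+-congˡ (conv-zeroˡ f (λ _ → refl) n)) (+-identityʳ _)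

-- Iterated over ℚ it supplies q innermost, then z₂, z₁ and t outermost; this is the argument order
-- of `reorder`.
Series : Ring → Ring
Series R = record
  { Carrier = ℕ → Carrier
  ; _≈_ = λ f g → ∀ n → f n ≈ g n
  ; _+_ = λ f g n → f n + g n
  ; _*_ = conv
  ; -_ = λ f n → - f n
  ; 0# = λ _ → 0#
  ; 1# = const 1#
  ; isCommutativeRing = record
    { isRing = record
      { +-isAbelianGroup = record
        { isGroup = record
          { isMonoid = record
            { isSemigroup = record
              { isMagma = record
                { isEquivalence = record
                  { refl = λ _ → refl
                  ; sym = λ p n → sym (p n)
                  ; trans = λ p r n → trans (p n) (r n)
                  }
                ; ∙-cong = λ p r n → +-cong (p n) (r n)
                }
              ; assoc = λ _ _ _ _ → +-assoc _ _ _
              }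
            ; identity = (λ _ _ → +-identityˡ _) , (λ _ _ → +-identityʳ _)
            }
          ; inverse = (λ _ _ → -‿inverseˡ _) , (λ _ _ → -‿inverseʳ _)
          ; ⁻¹-cong = λ p n → -‿cong (p n)
          }
        ; comm = λ _ _ _ → +-comm _ _
        }
      ; *-cong = conv-cong
      ; *-assoc = conv-assoc
      ; *-identity = identityˡ , λ f n → trans (conv-comm f (const 1#) n) (identityˡ f n)
      ; distrib = (λ f g h n → begin
            conv f (λ i → g i + h i) n ≈⟨ conv-comm f _ n ⟩
            conv (λ i → g i + h i) f n ≈⟨ conv-distribʳ g h f n ⟩
            conv g f n + conv h f n    ≈⟨ +-cong (conv-comm g f n) (conv-comm h f n) ⟩
            conv f g n + conv f h n    ∎)
          , λ h f g → conv-distribʳ f g h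
      }
    ; *-comm = conv-comm
    }
  }
  where
  open FiniteSums R
  identityˡ : ∀ f n → conv (const 1#) f n ≈ f n
  identityˡ f n = trans (conv-const 1# f n) (*-identityˡ _)

module _ (R : Ring) where
  private
    module R = FiniteSums R
    module R[x] = FiniteSums (Series R)

  Σ<-coeff : ∀ n (h : ℕ → ℕ → R.Carrier) x → R[x].Σ< n h x R.≈ R.Σ< n (λ i → h i x)
  Σ<-coeff zero    h x = R.refl
  Σ<-coeff (suc n) h x = R.+-congˡ (Σ<-coeff n (h ∘ suc) x)

  conv-coeff : ∀ (f g : ℕ → ℕ → R.Carrier) n x →
               R[x].conv f g n x R.≈ R.Σ< (suc n) (λ i → R.conv (f i) (g (n ∸ i)) x)
  conv-coeff f g n x = R.trans (R[x].conv-Σ< f g n x) (Σ<-coeff (suc n) (λ i → R.conv (f i) (g (n ∸ i))) x)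

-- Natural numbers and inverse factorials in ℚ.

ℚ-ring : Ring
ℚ-ring = ℚ.+-*-commutativeRing

private
  natᵘ : ℕ → ℚᵘ.ℚᵘ
  natᵘ n = ℚᵘ.mkℚᵘ (+ n) 0

ℕ→ℚ-+ : ∀ m n → ℕ→ℚ (m ℕ.+ n) ≡ ℕ→ℚ m ℚ.+ ℕ→ℚ n
ℕ→ℚ-+ m n = ℚ.toℚᵘ-injective (begin
  ℚ.toℚᵘ (ℕ→ℚ (m ℕ.+ n))                   ≈⟨ ℚ.toℚᵘ-fromℚᵘ (natᵘ (m ℕ.+ n)) ⟩
  natᵘ (m ℕ.+ n)
    ≈⟨ ℚᵘ.*≡* (≡.cong (ℤ._* (+ 1)) (≡.cong₂ ℤ._+_ (≡.sym (ℤ.*-identityʳ (+ m))) (≡.sym (ℤ.*-identityʳ (+ n))))) ⟩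
  natᵘ m ℚᵘ.+ natᵘ n                       ≈⟨ ℚᵘ.+-cong (ℚ.toℚᵘ-fromℚᵘ (natᵘ m)) (ℚ.toℚᵘ-fromℚᵘ (natᵘ n)) ⟨
  ℚ.toℚᵘ (ℕ→ℚ m) ℚᵘ.+ ℚ.toℚᵘ (ℕ→ℚ n)       ≈⟨ ℚ.toℚᵘ-homo-+ (ℕ→ℚ m) (ℕ→ℚ n) ⟨
  ℚ.toℚᵘ (ℕ→ℚ m ℚ.+ ℕ→ℚ n)                 ∎)
  where open ℚᵘ.≃-Reasoning

ℕ→ℚ-* : ∀ m n → ℕ→ℚ (m ℕ.* n) ≡ ℕ→ℚ m ℚ.* ℕ→ℚ n
ℕ→ℚ-* m n = ℚ.toℚᵘ-injective (begin
  ℚ.toℚᵘ (ℕ→ℚ (m ℕ.* n))                   ≈⟨ ℚ.toℚᵘ-fromℚᵘ (natᵘ (m ℕ.* n)) ⟩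
  natᵘ (m ℕ.* n)                           ≈⟨ ℚᵘ.*≡* (≡.cong (ℤ._* (+ 1)) (ℤ.pos-* m n)) ⟩
  natᵘ m ℚᵘ.* natᵘ n                       ≈⟨ ℚᵘ.*-cong (ℚ.toℚᵘ-fromℚᵘ (natᵘ m)) (ℚ.toℚᵘ-fromℚᵘ (natᵘ n)) ⟨
  ℚ.toℚᵘ (ℕ→ℚ m) ℚᵘ.* ℚ.toℚᵘ (ℕ→ℚ n)       ≈⟨ ℚ.toℚᵘ-homo-* (ℕ→ℚ m) (ℕ→ℚ n) ⟨
  ℚ.toℚᵘ (ℕ→ℚ m ℚ.* ℕ→ℚ n)                 ∎)
  where open ℚᵘ.≃-Reasoning

1/n*n≡1 : ∀ n .{{_ : ℕ.NonZero n}} → ((+ 1) ℚ./ n) ℚ.* ℕ→ℚ n ≡ 1ℚ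
1/n*n≡1 (suc n) = ℚ.toℚᵘ-injective (begin
  ℚ.toℚᵘ (((+ 1) ℚ./ suc n) ℚ.* ℕ→ℚ (suc n))           ≈⟨ ℚ.toℚᵘ-homo-* ((+ 1) ℚ./ suc n) (ℕ→ℚ (suc n)) ⟩
  ℚ.toℚᵘ ((+ 1) ℚ./ suc n) ℚᵘ.* ℚ.toℚᵘ (ℕ→ℚ (suc n))
    ≈⟨ ℚᵘ.*-cong (ℚ.toℚᵘ-fromℚᵘ (ℚᵘ.mkℚᵘ (+ 1) n)) (ℚ.toℚᵘ-fromℚᵘ (natᵘ (suc n))) ⟩
  ℚᵘ.mkℚᵘ (+ 1) n ℚᵘ.* natᵘ (suc n)
    ≈⟨ ℚᵘ.*≡* (≡.cong +_ (≡.trans (ℕ.*-identityʳ _) (≡.sym (≡.cong (1 ℕ.*_) (ℕ.*-identityʳ (suc n)))))) ⟩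
  ℚᵘ.1ℚᵘ ∎)
  where open ℚᵘ.≃-Reasoning

inv!-suc : ∀ n → ℕ→ℚ (suc n) ℚ.* inv! (suc n) ≡ inv! n
inv!-suc n = begin
  s ℚ.* inv! (suc n)                          ≡⟨ ℚ.*-identityʳ _ ⟨
  s ℚ.* inv! (suc n) ℚ.* 1ℚ                   ≡⟨ ≡.cong (s ℚ.* inv! (suc n) ℚ.*_) (≡.sym (1/n*n≡1 (n !) {{n ℕ.!≢0}})) ⟩
  s ℚ.* inv! (suc n) ℚ.* (inv! n ℚ.* f)
    ≡⟨ solve 4 (λ a b c d → (a :* b) :* (c :* d) := c :* (b :* (a :* d))) ≡.refl s (inv! (suc n)) (inv! n) f ⟩
  inv! n ℚ.* (inv! (suc n) ℚ.* (s ℚ.* f))     ≡⟨ ≡.cong (λ x → inv! n ℚ.* (inv! (suc n) ℚ.* x)) (≡.sym (ℕ→ℚ-* (suc n) (n !))) ⟩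
  inv! n ℚ.* (inv! (suc n) ℚ.* ℕ→ℚ (suc n !)) ≡⟨ ≡.cong (inv! n ℚ.*_) (1/n*n≡1 (suc n !) {{suc n ℕ.!≢0}}) ⟩
  inv! n ℚ.* 1ℚ                               ≡⟨ ℚ.*-identityʳ _ ⟩
  inv! n                                      ∎
  where
  open ≡.≡-Reasoning
  open FiniteSums ℚ-ring using (solve; _:=_; _:*_)
  s f : ℚ
  s = ℕ→ℚ (suc n)
  f = ℕ→ℚ (n !)

-- Rational spans of families of functions.

record ℚ-Algebra (S : Ring) : Set where
  open CommutativeRing S
  field
    ι   : ℚ → Carrier
    ι-+ : ∀ a b → ι (a ℚ.+ b) ≈ ι a + ι b
    ι-* : ∀ a b → ι (a ℚ.* b) ≈ ι a * ι b
    ι-0 : ι 0ℚ ≈ 0#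
    ι-1 : ι 1ℚ ≈ 1#

module Spans (S : Ring) (A : ℚ-Algebra S) where
  open FiniteSums S public
  open ℚ-Algebra A public
  open import Algebra.Properties.Semiring.Exp semiring public using (_^_; ^-congˡ; ^-homo-*; ^-assocʳ)
  open import Algebra.Properties.CommutativeSemiring.Exp commutativeSemiring public using (^-distrib-*)

  nat : ℕ → Carrier
  nat n = ι (ℕ→ℚ n)

  nat-+ : ∀ m n → nat (m ℕ.+ n) ≈ nat m + nat n
  nat-+ m n = trans (reflexive (≡.cong ι (ℕ→ℚ-+ m n))) (ι-+ _ _)

  nat-suc : ∀ n → nat (suc n) ≈ 1# + nat n
  nat-suc n = trans (nat-+ 1 n) (+-congʳ ι-1)

  ι-1*≈- : ∀ x → ι (ℚ.- 1ℚ) * x ≈ - x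
  ι-1*≈- x = begin
    ι (ℚ.- 1ℚ) * x                   ≈⟨ +-identityʳ _ ⟨
    ι (ℚ.- 1ℚ) * x + 0#              ≈⟨ +-congˡ (-‿inverseʳ x) ⟨
    ι (ℚ.- 1ℚ) * x + (x + - x)       ≈⟨ +-congˡ (+-congʳ (trans (*-congʳ ι-1) (*-identityˡ x))) ⟨
    ι (ℚ.- 1ℚ) * x + (ι 1ℚ * x + - x) ≈⟨ solve 4 (λ a b c d → a :* c :+ (b :* c :+ d) := (a :+ b) :* c :+ d) refl _ _ _ _ ⟩
    (ι (ℚ.- 1ℚ) + ι 1ℚ) * x + - x    ≈⟨ +-congʳ (*-congʳ (trans (sym (ι-+ (ℚ.- 1ℚ) 1ℚ)) ι-0)) ⟩
    0# * x + - x                     ≈⟨ +-congʳ (zeroˡ x) ⟩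
    0# + - x                         ≈⟨ +-identityˡ _ ⟩
    - x                              ∎

  -- Functions are compared pointwise, so compatibility with `≈` has to be a field of its own.
  record Linear {X Y : Set} (T : (X → Carrier) → Y → Carrier) : Set where
    field
      T-cong : ∀ {f g} → (∀ x → f x ≈ g x) → ∀ y → T f y ≈ T g y
      T-+    : ∀ f g y → T (λ x → f x + g x) y ≈ T f y + T g y
      T-*    : ∀ a f y → T (λ x → ι a * f x) y ≈ ι a * T f y

    T-0 : ∀ y → T (λ _ → 0#) y ≈ 0#
    T-0 y = trans (T-cong (λ _ → sym (zeroʳ (ι 0ℚ))) y) (trans (T-* 0ℚ _ y) (trans (*-congʳ ι-0) (zeroˡ _)))

  linear-∘ : ∀ {X Y Z : Set} {U : (Y → Carrier) → Z → Carrier} {T : (X → Carrier) → Y → Carrier} →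
             Linear U → Linear T → Linear (U ∘ T)
  linear-∘ {T = T} u t = record
    { T-cong = λ e → u.T-cong (t.T-cong e)
    ; T-+ = λ f g z → trans (u.T-cong (t.T-+ f g) z) (u.T-+ (T f) (T g) z)
    ; T-* = λ a f z → trans (u.T-cong (t.T-* a f) z) (u.T-* a (T f) z)
    }
    where
    module u = Linear u
    module t = Linear t

  module _ {I X : Set} (w : I → X → Carrier) where

    combination : List (ℚ × I) → X → Carrier
    combination []             x = 0#
    combination ((c , i) ∷ cs) x = ι c * w i x + combination cs x

    -- One list of rational coefficients serves all `x` at once. Hence an expansion can be pushed
    -- through sums and convolutions over the arguments, which is what `span-map` does.
    Span : (I → Set) → (X → Carrier) → Set
    Span P f = Σ (List (ℚ × I)) λ cs → All (P ∘ proj₂) cs × (∀ x → f x ≈ combination cs x)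

  module _ {I X : Set} {w : I → X → Carrier} {P : I → Set} where

    span-cong : ∀ {f g} → (∀ x → f x ≈ g x) → Span w P g → Span w P f
    span-cong e (cs , ps , h) = cs , ps , λ x → trans (e x) (h x)

    span-gen : ∀ {i} → P i → Span w P (w i)
    span-gen {i} p = ((1ℚ , i) ∷ []) , (p ∷ []) ,
      λ x → sym (trans (+-identityʳ _) (trans (*-congʳ ι-1) (*-identityˡ _)))

    span-0 : Span w P (λ _ → 0#)
    span-0 = [] , [] , λ _ → refl

    combination-++ : ∀ cs ds x → combination w (cs ++ ds) x ≈ combination w cs x + combination w ds x
    combination-++ []       ds x = sym (+-identityˡ _)
    combination-++ (c ∷ cs) ds x = trans (+-congˡ (combination-++ cs ds x)) (sym (+-assoc _ _ _))

    span-+ : ∀ {f g} → Span w P f → Span w P g → Span w P (λ x → f x + g x)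
    span-+ (cs , ps , h) (ds , rs , k) =
      (cs ++ ds) , All.++⁺ ps rs , λ x → trans (+-cong (h x) (k x)) (sym (combination-++ cs ds x))

    scale : ℚ → List (ℚ × I) → List (ℚ × I)
    scale a []             = []
    scale a ((c , i) ∷ cs) = (a ℚ.* c , i) ∷ scale a cs

    scale-All : ∀ a {cs} → All (P ∘ proj₂) cs → All (P ∘ proj₂) (scale a cs)
    scale-All a []       = []
    scale-All a (p ∷ ps) = p ∷ scale-All a ps

    combination-scale : ∀ a cs x → combination w (scale a cs) x ≈ ι a * combination w cs x
    combination-scale a []             x = sym (zeroʳ _)
    combination-scale a ((c , i) ∷ cs) x = trans
      (+-cong (trans (*-congʳ (ι-* a c)) (*-assoc _ _ _)) (combination-scale a cs x))
      (sym (distribˡ _ _ _))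

    span-* : ∀ {f} a → Span w P f → Span w P (λ x → ι a * f x)
    span-* a (cs , ps , h) =
      scale a cs , scale-All a ps , λ x → trans (*-congˡ (h x)) (sym (combination-scale a cs x))

    span-neg : ∀ {f} → Span w P f → Span w P (λ x → - f x)
    span-neg s = span-cong (λ x → sym (ι-1*≈- _)) (span-* (ℚ.- 1ℚ) s)

    span-Σ< : ∀ n {f : ℕ → X → Carrier} → (∀ i → i < n → Span w P (f i)) →
              Span w P (λ x → Σ< n (λ i → f i x))
    span-Σ< zero    s = span-0
    span-Σ< (suc n) s = span-+ (s 0 (s≤s z≤n)) (span-Σ< n (λ i i<n → s (suc i) (s≤s i<n)))

  span-mono : ∀ {I X : Set} {w : I → X → Carrier} {P Q : I → Set} {f} →
              (∀ {i} → P i → Q i) → Span w P f → Span w Q f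
  span-mono r (cs , ps , h) = cs , All.map r ps , h

  span-map : ∀ {I J X Y : Set} {w : I → X → Carrier} {v : J → Y → Carrier} {P : I → Set} {Q : J → Set}
             {T : (X → Carrier) → Y → Carrier} → Linear T →
             (∀ i → P i → Span v Q (T (w i))) → ∀ {f} → Span w P f → Span v Q (T f)
  span-map {w = w} {v} {P} {Q} {T} L s (cs , ps , h) = span-cong (T-cong h) (go cs ps)
    where
    open Linear L
    go : ∀ cs → All (P ∘ proj₂) cs → Span v Q (T (combination w cs))
    go []             []       = span-cong T-0 span-0
    go ((c , i) ∷ cs) (p ∷ ps) =
      span-cong (λ y → trans (T-+ _ _ y) (+-congʳ (T-* _ _ y)))
        (span-+ (span-* c (s i p)) (go cs ps))

-- Chains of blocks, and the pairing of two chains as a combination of bi-brackets.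

module Chains (S : Ring) (A : ℚ-Algebra S) (q : CommutativeRing.Carrier S) where
  open Spans S A public

  -- The product of Σ φ(d) t^(d+1) with Σ a(i) t^i: blocks have length at least 1, and the index `d`
  -- stands for the length d + 1.
  conv⁺ : (ℕ → Carrier) → (ℕ → Carrier) → ℕ → Carrier
  conv⁺ φ a zero    = 0#
  conv⁺ φ a (suc j) = conv φ a j

  conv⁺-Σ< : ∀ φ a j → conv⁺ φ a j ≈ Σ< j (λ d → φ d * a (j ∸ suc d))
  conv⁺-Σ< φ a zero    = refl
  conv⁺-Σ< φ a (suc j) = conv-Σ< φ a j

  conv⁺-suc : ∀ φ a j → conv⁺ φ a (suc j) ≈ φ 0 * a j + conv⁺ (φ ∘ suc) a j
  conv⁺-suc φ a zero    = sym (+-identityʳ _)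
  conv⁺-suc φ a (suc j) = refl

  conv⁺-cong : ∀ {φ ψ a b} → (∀ d → φ d ≈ ψ d) → (∀ i → a i ≈ b i) → ∀ j → conv⁺ φ a j ≈ conv⁺ ψ b j
  conv⁺-cong p r zero    = refl
  conv⁺-cong p r (suc j) = conv-cong p r j

  conv⁺-*ˡ : ∀ c φ a j → conv⁺ (λ d → c * φ d) a j ≈ c * conv⁺ φ a j
  conv⁺-*ˡ c φ a zero    = sym (zeroʳ _)
  conv⁺-*ˡ c φ a (suc j) = conv-*ˡ c φ a j

  conv⁺-+ˡ : ∀ φ ψ a j → conv⁺ (λ d → φ d + ψ d) a j ≈ conv⁺ φ a j + conv⁺ ψ a j
  conv⁺-+ˡ φ ψ a zero    = sym (+-identityʳ _)
  conv⁺-+ˡ φ ψ a (suc j) = conv-distribʳ φ ψ a j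

  conv-*ʳ : ∀ c f g n → conv f (λ i → c * g i) n ≈ c * conv f g n
  conv-*ʳ c f g n = trans (conv-comm f _ n) (trans (conv-*ˡ c g f n) (*-congˡ (conv-comm g f n)))

  conv-distribˡ : ∀ f g h n → conv f (λ i → g i + h i) n ≈ conv f g n + conv f h n
  conv-distribˡ f g h n =
    trans (conv-comm f _ n) (trans (conv-distribʳ g h f n) (+-cong (conv-comm g f n) (conv-comm h f n)))

  conv⁺-*ʳ : ∀ c φ a j → conv⁺ φ (λ i → c * a i) j ≈ c * conv⁺ φ a j
  conv⁺-*ʳ c φ a zero    = sym (zeroʳ _)
  conv⁺-*ʳ c φ a (suc j) = conv-*ʳ c φ a j

  conv⁺-linear : ∀ φ → Linear (conv⁺ φ)
  conv⁺-linear φ = record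
    { T-cong = conv⁺-cong (λ _ → refl)
    ; T-+ = λ { f g zero → sym (+-identityʳ _) ; f g (suc j) → conv-distribˡ φ f g j }
    ; T-* = λ a → conv⁺-*ʳ (ι a) φ
    }

  -- Strict partial sums multiply a generating function by X / (1 - X), and this commutes with the
  -- Cauchy product. It turns a sum over lower levels on one side into a sum over smaller `g`.
  conv-Σ<ˡ : ∀ x y g → conv (λ n → Σ< n x) y g ≈ Σ< g (conv x y)
  conv-Σ<ˡ x y zero    = zeroˡ _
  conv-Σ<ˡ x y (suc g) = begin
    0# * y (suc g) + conv (λ n → Σ< (suc n) x) y g ≈⟨ trans (+-congʳ (zeroˡ _)) (+-identityˡ _) ⟩
    conv (λ n → Σ< (suc n) x) y g                  ≈⟨ conv-cong (λ n → Σ<-last n x) (λ _ → refl) g ⟩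
    conv (λ n → Σ< n x + x n) y g                  ≈⟨ conv-distribʳ _ x y g ⟩
    conv (λ n → Σ< n x) y g + conv x y g           ≈⟨ +-congʳ (conv-Σ<ˡ x y g) ⟩
    Σ< g (conv x y) + conv x y g                   ≈⟨ Σ<-last g (conv x y) ⟨
    Σ< (suc g) (conv x y)                          ∎

  conv-Σ<ʳ : ∀ x y g → conv x (λ n → Σ< n y) g ≈ Σ< g (conv x y)
  conv-Σ<ʳ x y g = trans (conv-comm x _ g) (trans (conv-Σ<ˡ y x g) (Σ<-cong g (conv-comm y x)))

  -- The value h(g′) occurs g - 1 - g′ times in the double sum, and (g - 1 - g′) + (g′ + 1) + 1 = g
  -- + 1. The multipliers are written as g + 1 and g′ + 1 because these are the values of the
  -- variables u.
  Σ<Σ< : ∀ h g → Σ< g (λ g′ → Σ< g′ h) + (Σ< g (λ g′ → nat (suc g′) * h g′) + Σ< g h) ≈ nat (suc g) * Σ< g h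
  Σ<Σ< h zero    = trans (+-identityˡ _) (trans (+-identityˡ _) (sym (zeroʳ _)))
  Σ<Σ< h (suc g) = begin
    Σ< (suc g) (λ g′ → Σ< g′ h) + (Σ< (suc g) (λ g′ → nat (suc g′) * h g′) + Σ< (suc g) h)
      ≈⟨ +-cong (Σ<-last g _) (+-cong (Σ<-last g _) (Σ<-last g _)) ⟩
    (Σ< g (λ g′ → Σ< g′ h) + Σ< g h) + ((Σ< g (λ g′ → nat (suc g′) * h g′) + nat (suc g) * h g) + (Σ< g h + h g))
      ≈⟨ solve 5 (λ a b c d e → (a :+ b) :+ ((c :+ d) :+ (b :+ e)) := (a :+ (c :+ b)) :+ ((b :+ e) :+ d)) refl _ _ _ _ _ ⟩
    (Σ< g (λ g′ → Σ< g′ h) + (Σ< g (λ g′ → nat (suc g′) * h g′) + Σ< g h)) + ((Σ< g h + h g) + nat (suc g) * h g)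
      ≈⟨ +-congʳ (Σ<Σ< h g) ⟩
    nat (suc g) * Σ< g h + ((Σ< g h + h g) + nat (suc g) * h g)
      ≈⟨ solve 3 (λ d b e → d :* b :+ ((b :+ e) :+ d :* e) := (b :+ e) :+ d :* (b :+ e)) refl _ _ _ ⟩
    (Σ< g h + h g) + nat (suc g) * (Σ< g h + h g)
      ≈⟨ trans (+-congʳ (sym (*-identityˡ _))) (sym (distribʳ _ _ _)) ⟩
    (1# + nat (suc g)) * (Σ< g h + h g)
      ≈⟨ *-cong (nat-suc (suc g)) (Σ<-last g h) ⟨
    nat (suc (suc g)) * Σ< (suc g) h ∎

  -- (Σ_D A_D)(Σ_E B_E), split according to D = E, D < E, D > E and summed over the minimum.
  conv⁺-product : ∀ φ ψ a b j → conv⁺ φ a j * conv⁺ ψ b j ≈ Σ< j (λ f →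
      φ f * ψ f * (a (j ∸ suc f) * b (j ∸ suc f))
    + φ f * (a (j ∸ suc f) * conv⁺ (λ e → ψ (suc f ℕ.+ e)) b (j ∸ suc f))
    + ψ f * (conv⁺ (λ d → φ (suc f ℕ.+ d)) a (j ∸ suc f) * b (j ∸ suc f)))
  conv⁺-product φ ψ a b zero    = zeroˡ _
  conv⁺-product φ ψ a b (suc j) = begin
    conv⁺ φ a (suc j) * conv⁺ ψ b (suc j) ≈⟨ *-cong (conv⁺-suc φ a j) (conv⁺-suc ψ b j) ⟩
    -- The products with D = 1 or E = 1 form the summand `f = 0`; if both lengths exceed 1, both are
    -- lowered by 1.
    (φ 0 * a j + conv⁺ (φ ∘ suc) a j) * (ψ 0 * b j + conv⁺ (ψ ∘ suc) b j)
      ≈⟨ solve 6 (λ p x A r y B → (p :* x :+ A) :* (r :* y :+ B)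
            := (p :* r :* (x :* y) :+ p :* (x :* B) :+ r :* (A :* y)) :+ A :* B) refl _ _ _ _ _ _ ⟩
    _ + conv⁺ (φ ∘ suc) a j * conv⁺ (ψ ∘ suc) b j ≈⟨ +-congˡ (conv⁺-product (φ ∘ suc) (ψ ∘ suc) a b j) ⟩
    _ ∎

  -- One block of length D = d + 1 at level `n`, followed by `h n`. The base `ρ` is a parameter
  -- because the two sides differ: it is q^n for the factor in y and q^(m+1) for the factor in q/y.
  layer : (ℕ → Carrier) → ℕ → (ℕ → ℕ → Carrier) → ℕ → ℕ → Carrier
  layer ρ α h n j = conv⁺ (λ d → nat (suc d) ^ α * ρ n ^ suc d) (h n) j

  -- The coefficient of t^j of
  --   Σ_{n > n₁ > ⋯ > n_k ≥ 0} Σ_{D₁,…,D_k ≥ 1} Π D_i^{α_i} ρ(n_i)^{D_i} t^{D_i}.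
  chain : (ℕ → Carrier) → List ℕ → ℕ → ℕ → Carrier
  chain ρ []       n j = const 1# j
  chain ρ (α ∷ αs) n j = Σ< n (λ n′ → layer ρ α (chain ρ αs) n′ j)

  τ : ℕ → Carrier
  τ g = q ^ suc g

  -- brackets L g j collects the terms u₁ ≤ g, v₁ + ⋯ + v_ℓ = j of the bi-bracket, without the factorials.
  brackets : BiIdx → ℕ → ℕ → Carrier
  brackets []            g j = const 1# j
  brackets ((s , r) ∷ L) g j = Σ< g (λ g′ → nat (suc g′) ^ r * layer τ (s ∸ 1) (brackets L) g′ j)

  Index : Set
  Index = (ℕ × ℕ) × BiIdx

  -- The part of `brackets ((s , r) ∷ L)` with u₁ = g + 1 exactly; `cumulative` restores the sum
  -- over u₁ ≤ g. Keeping u₁ fixed is what allows a further variable to be put in front.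
  top : Index → ℕ × ℕ → Carrier
  top ((s , r) , L) (g , j) = nat (suc g) ^ r * layer τ (s ∸ 1) (brackets L) g j

  cumulative : (ℕ × ℕ → Carrier) → ℕ × ℕ → Carrier
  cumulative h (g , j) = Σ< g (λ g′ → h (g′ , j))

  cumulative-linear : Linear cumulative
  cumulative-linear = record
    { T-cong = λ e (g , j) → Σ<-cong g (λ g′ → e (g′ , j))
    ; T-+ = λ f h (g , j) → Σ<-+ g _ _
    ; T-* = λ a f (g , j) → Σ<-*ˡ g (ι a) _
    }

  -- The bound `μ` is 1 for the first variable of the final bi-brackets, where s₁ > 1 is required,
  -- and 0 inside the recursion, where s ≥ 1 is enough.
  Admissible : ℕ → ℕ → Index → Set
  Admissible W μ ((s , r) , L) = μ < s × ValidBi L × s ℕ.+ r ℕ.+ weight L ≤ W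

  prepend : ℕ → (ℕ × ℕ → Carrier) → ℕ × ℕ → Carrier
  prepend a k (g , j) = layer τ a (λ g′ i → k (g′ , i)) g j

  prepend-linear : ∀ a → Linear (prepend a)
  prepend-linear a = record
    { T-cong = λ e (g , j) → Linear.T-cong (lin g) (λ i → e (g , i)) j
    ; T-+ = λ f h (g , j) → Linear.T-+ (lin g) _ _ j
    ; T-* = λ c f (g , j) → Linear.T-* (lin g) c _ j
    }
    where lin = λ g → conv⁺-linear (λ d → nat (suc d) ^ a * τ g ^ suc d)

  -- Up to a factor 1, prepending to `cumulative (top i)` is `top` of the index with `(suc a , 0)`
  -- in front, which adds a + 1 to the weight.
  prepend-cumulative : ∀ {W W′ μ a h} → μ ≤ a → suc a ℕ.+ W ≤ W′ →
    Span (cumulative ∘ top) (Admissible W 0) h → Span top (Admissible W′ μ) (prepend a h)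
  prepend-cumulative {W} {W′} {μ} {a} μ≤a le = span-map (prepend-linear a) gen
    where
    gen : ∀ i → Admissible W 0 i → Span top (Admissible W′ μ) (prepend a (cumulative (top i)))
    gen ((s , r) , L) (s>0 , valid , wt) = span-cong (λ (g , j) → sym (*-identityˡ _))
      (span-gen {i = (suc a , 0) , ((s , r) ∷ L)} (s≤s μ≤a , (s>0 , valid) ,
        ℕ.≤-trans (ℕ.+-mono-≤ (ℕ.≤-reflexive (ℕ.+-identityʳ (suc a))) wt) le))

  -- By `Σ<Σ<` the twofold sum is (g + 1) `C` - `C¹` - `C`. The factor g + 1 is the new u and gives
  -- the pair `(suc a , 1)`; `C¹` has the next exponent r raised by 1. Both cost one unit of weight
  -- more than a single sum.
  prepend-cumulative² : ∀ {W W′ μ a h} → μ ≤ a → suc (suc a) ℕ.+ W ≤ W′ →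
    Span top (Admissible W 0) h → Span top (Admissible W′ μ) (prepend a (cumulative (cumulative h)))
  prepend-cumulative² {W} {W′} {μ} {a} μ≤a le =
    span-map (linear-∘ (prepend-linear a) (linear-∘ cumulative-linear cumulative-linear)) gen
    where
    gen : ∀ i → Admissible W 0 i → Span top (Admissible W′ μ) (prepend a (cumulative (cumulative (top i))))
    gen ((s , r) , L) (s>0 , valid , wt) = span-cong eq
      (span-+ (span-gen {i = (suc a , 1) , ((s , r) ∷ L)} (s≤s μ≤a , (s>0 , valid) , le₁))
        (span-neg (span-+
          (span-gen {i = (suc a , 0) , ((s , suc r) ∷ L)} (s≤s μ≤a , (s>0 , valid) , le₂))
          (span-gen {i = (suc a , 0) , ((s , r) ∷ L)} (s≤s μ≤a , (s>0 , valid) , le₃)))))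
      where
      open Linear (prepend-linear a) using (T-cong; T-+)
      le₁ : suc a ℕ.+ 1 ℕ.+ (s ℕ.+ r ℕ.+ weight L) ≤ W′
      le₁ = ℕ.≤-trans (ℕ.+-mono-≤ (ℕ.≤-reflexive (ℕ.+-comm (suc a) 1)) wt) le
      le₂ : suc a ℕ.+ 0 ℕ.+ (s ℕ.+ suc r ℕ.+ weight L) ≤ W′
      le₂ = ℕ.≤-trans (ℕ.≤-reflexive (shift-1 a s r (weight L))) le₁
        where
        shift-1 : ∀ a s r l → suc a ℕ.+ 0 ℕ.+ (s ℕ.+ suc r ℕ.+ l) ≡ suc a ℕ.+ 1 ℕ.+ (s ℕ.+ r ℕ.+ l)
        shift-1 = solve-∀
      le₃ : suc a ℕ.+ 0 ℕ.+ (s ℕ.+ r ℕ.+ weight L) ≤ W′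
      le₃ = ℕ.≤-trans (ℕ.+-monoˡ-≤ _ (ℕ.+-monoʳ-≤ (suc a) z≤n)) le₁
      h = top ((s , r) , L)
      C C¹ CC : ℕ × ℕ → Carrier
      C = cumulative h
      C¹ = cumulative (top ((s , suc r) , L))
      CC = cumulative (cumulative h)
      φ : ℕ → ℕ → Carrier
      φ g d = nat (suc d) ^ a * τ g ^ suc d
      sum : ∀ x → CC x + (C¹ x + C x) ≈ nat (suc (proj₁ x)) * C x
      sum (g , j) = trans (+-congˡ (+-congʳ (Σ<-cong g (λ g′ → *-assoc _ _ _)))) (Σ<Σ< (λ g′ → h (g′ , j)) g)
      eq : ∀ x → prepend a CC x ≈ top ((suc a , 1) , ((s , r) ∷ L)) x
             + - (top ((suc a , 0) , ((s , suc r) ∷ L)) x + top ((suc a , 0) , ((s , r) ∷ L)) x)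
      eq x@(g , j) = begin
        prepend a CC x                                       ≈⟨ +-identityʳ _ ⟨
        prepend a CC x + 0#                                  ≈⟨ +-congˡ (-‿inverseʳ _) ⟨
        prepend a CC x + (R + - R)                           ≈⟨ +-assoc _ _ _ ⟨
        (prepend a CC x + R) + - R                           ≈⟨ +-congʳ (+-congˡ (+-cong (*-identityˡ _) (*-identityˡ _))) ⟩
        (prepend a CC x + (prepend a C¹ x + prepend a C x)) + - R
          ≈⟨ +-congʳ (trans (+-congˡ (sym (T-+ C¹ C x))) (sym (T-+ CC (λ y → C¹ y + C y) x))) ⟩
        prepend a (λ y → CC y + (C¹ y + C y)) x + - R        ≈⟨ +-congʳ (T-cong sum x) ⟩
        prepend a (λ y → nat (suc (proj₁ y)) * C y) x + - R  ≈⟨ +-congʳ (conv⁺-*ʳ (nat (suc g)) (φ g) (λ i → C (g , i)) j) ⟩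
        nat (suc g) * prepend a C x + - R                    ≈⟨ +-congʳ (*-congʳ (*-identityʳ _)) ⟨
        _                                                    ∎
        where R = top ((suc a , 0) , ((s , suc r) ∷ L)) x + top ((suc a , 0) , ((s , r) ∷ L)) x

  -- Σ_{d ≥ 1} (f + 1 + d)^β d^p (ρ n)^d h(n, j - d)
  shifted : (ℕ → Carrier) → ℕ → ℕ → ℕ → (ℕ → ℕ → Carrier) → ℕ → ℕ → Carrier
  shifted ρ f β p h n j = conv⁺ (λ e → nat (suc f ℕ.+ suc e) ^ β * (nat (suc e) ^ p * ρ n ^ suc e)) (h n) j

  -- Compared with `prepend`, the remainder may still depend on the length f + 1 of the piece in
  -- front. Once this dependence is a factor (f + 1)^a, `outer-prepend` applies.
  outer : (ℕ → ℕ × ℕ → Carrier) → ℕ × ℕ → Carrier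
  outer h (g , j) = Σ< j (λ f → τ g ^ suc f * h f (g , j ∸ suc f))

  outer-cong : ∀ {h k} → (∀ f x → h f x ≈ k f x) → ∀ x → outer h x ≈ outer k x
  outer-cong e (g , j) = Σ<-cong j (λ f → *-congˡ (e f _))

  outer-+ : ∀ h k x → outer (λ f y → h f y + k f y) x ≈ outer h x + outer k x
  outer-+ h k (g , j) = trans (Σ<-cong j (λ f → distribˡ _ _ _)) (Σ<-+ j _ _)

  outer-prepend : ∀ a k x → outer (λ f y → nat (suc f) ^ a * k y) x ≈ prepend a k x
  outer-prepend a k (g , j) = trans
    (Σ<-cong j (λ f → solve 3 (λ x y z → x :* (y :* z) := y :* x :* z) refl _ _ _))
    (sym (conv⁺-Σ< (λ d → nat (suc d) ^ a * τ g ^ suc d) (λ i → k (g , i)) j))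

  -- In each case of `conv⁺-product` both blocks contain the common piece of length f + 1, so
  -- ρ(n)^(f+1) σ(m)^(f+1) factors out. Of the longer block a remainder of length e + 1 is left at
  -- the same level, while its power still refers to the full length f + 1 + e + 1.
  layer-product : ∀ ρ σ α β a b n m j →
    layer ρ α a n j * layer σ β b m j ≈ Σ< j (λ f → (ρ n * σ m) ^ suc f *
      (nat (suc f) ^ α * nat (suc f) ^ β * (a n (j ∸ suc f) * b m (j ∸ suc f))
      + nat (suc f) ^ α * (a n (j ∸ suc f) * shifted σ f β 0 b m (j ∸ suc f))
      + nat (suc f) ^ β * (shifted ρ f α 0 a n (j ∸ suc f) * b m (j ∸ suc f))))
  layer-product ρ σ α β a b n m j = trans (conv⁺-product _ _ (a n) (b m) j) (Σ<-cong j λ f →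
    let
      r = ρ n ^ suc f
      s = σ m ^ suc f
      x = nat (suc f) ^ α
      y = nat (suc f) ^ β
      i = j ∸ suc f
      pull : ∀ (ρ : ℕ → Carrier) β h n →
        conv⁺ (λ e → nat (suc (suc f ℕ.+ e)) ^ β * ρ n ^ suc (suc f ℕ.+ e)) (h n) i
          ≈ ρ n ^ suc f * shifted ρ f β 0 h n i
      pull ρ β h n = trans (conv⁺-cong (λ e → begin
          nat (suc (suc f ℕ.+ e)) ^ β * ρ n ^ suc (suc f ℕ.+ e)
            ≈⟨ reflexive (≡.cong (λ k → nat k ^ β * ρ n ^ k) (≡.sym (ℕ.+-suc (suc f) e))) ⟩
          nat (suc f ℕ.+ suc e) ^ β * ρ n ^ (suc f ℕ.+ suc e)
            ≈⟨ *-congˡ (^-homo-* (ρ n) (suc f) (suc e)) ⟩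
          nat (suc f ℕ.+ suc e) ^ β * (ρ n ^ suc f * ρ n ^ suc e)
            ≈⟨ solve 3 (λ x y z → x :* (y :* z) := y :* (x :* z)) refl _ _ _ ⟩
          ρ n ^ suc f * (nat (suc f ℕ.+ suc e) ^ β * ρ n ^ suc e)
            ≈⟨ *-congˡ (*-congˡ (*-identityˡ _)) ⟨
          ρ n ^ suc f * (nat (suc f ℕ.+ suc e) ^ β * (1# * ρ n ^ suc e)) ∎)
        (λ _ → refl) i) (conv⁺-*ˡ _ _ (h n) i)
    in begin
      (x * r) * (y * s) * (a n i * b m i) + (x * r) * (a n i * _) + (y * s) * (_ * b m i)
        ≈⟨ +-cong (+-congˡ (*-congˡ (*-congˡ (pull σ β b m)))) (*-congˡ (*-congʳ (pull ρ α a n))) ⟩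
      (x * r) * (y * s) * (a n i * b m i) + (x * r) * (a n i * (s * shifted σ f β 0 b m i))
        + (y * s) * ((r * shifted ρ f α 0 a n i) * b m i)
        ≈⟨ solve 8 (λ x r y s a b u v → (x :* r) :* (y :* s) :* (a :* b) :+ (x :* r) :* (a :* (s :* u))
              :+ (y :* s) :* ((r :* v) :* b)
              := (r :* s) :* (x :* y :* (a :* b) :+ x :* (a :* u) :+ y :* (v :* b))) refl _ _ _ _ _ _ _ _ ⟩
      (r * s) * _ ≈⟨ *-congʳ (^-distrib-* (ρ n) (σ m) (suc f)) ⟨
      (ρ n * σ m) ^ suc f * _ ∎)

  -- On n + m = g the base ρ(n) σ(m) of the common piece is the constant τ(g), so it leaves the
  -- convolution over levels. The three summands are the cases D = E, D < E and D > E.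
  conv-layers : ∀ ρ σ → (∀ n m → ρ n * σ m ≈ τ (n ℕ.+ m)) → ∀ α β a b x →
    conv (λ n → layer ρ α a n (proj₂ x)) (λ m → layer σ β b m (proj₂ x)) (proj₁ x) ≈ outer (λ f (g , i) →
        nat (suc f) ^ (α ℕ.+ β) * conv (λ n → a n i) (λ m → b m i) g
      + nat (suc f) ^ α * conv (λ n → a n i) (λ m → shifted σ f β 0 b m i) g
      + nat (suc f) ^ β * conv (λ n → shifted ρ f α 0 a n i) (λ m → b m i) g) x
  conv-layers ρ σ ρσ≈τ α β a b (g , j) = begin
    conv (λ n → layer ρ α a n j) (λ m → layer σ β b m j) g
      ≈⟨ conv-Σ< (λ n → layer ρ α a n j) (λ m → layer σ β b m j) g ⟩
    Σ< (suc g) (λ n → layer ρ α a n j * layer σ β b (g ∸ n) j)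
      ≈⟨ Σ<-cong (suc g) (λ n → layer-product ρ σ α β a b n (g ∸ n) j) ⟩
    Σ< (suc g) (λ n → Σ< j (λ f → (ρ n * σ (g ∸ n)) ^ suc f * H f n))
      ≈⟨ Σ<-cong< (suc g) (λ { n (s≤s n≤g) → Σ<-cong j (λ f → *-congʳ {x = H f n} (^-congˡ (suc f)
           (trans (ρσ≈τ n (g ∸ n)) (reflexive (≡.cong τ (ℕ.m+[n∸m]≡n n≤g)))))) }) ⟩
    Σ< (suc g) (λ n → Σ< j (λ f → τ g ^ suc f * H f n))
      ≈⟨ Σ<-swap (suc g) j (λ n f → τ g ^ suc f * H f n) ⟩
    Σ< j (λ f → Σ< (suc g) (λ n → τ g ^ suc f * H f n))
      ≈⟨ Σ<-cong j (λ f → trans (Σ<-*ˡ (suc g) _ (H f)) (*-congˡ (collect f))) ⟩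
    _ ∎
    where
    H₁ H₂ H₃ H : ℕ → ℕ → Carrier
    H₁ f n = nat (suc f) ^ α * nat (suc f) ^ β * (a n (j ∸ suc f) * b (g ∸ n) (j ∸ suc f))
    H₂ f n = nat (suc f) ^ α * (a n (j ∸ suc f) * shifted σ f β 0 b (g ∸ n) (j ∸ suc f))
    H₃ f n = nat (suc f) ^ β * (shifted ρ f α 0 a n (j ∸ suc f) * b (g ∸ n) (j ∸ suc f))
    H f n = H₁ f n + H₂ f n + H₃ f n
    pull : ∀ c u v → Σ< (suc g) (λ n → c * (u n * v (g ∸ n))) ≈ c * conv u v g
    pull c u v = trans (Σ<-*ˡ (suc g) c (λ n → u n * v (g ∸ n))) (*-congˡ (sym (conv-Σ< u v g)))
    collect : ∀ f → Σ< (suc g) (H f) ≈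
        nat (suc f) ^ (α ℕ.+ β) * conv (λ n → a n (j ∸ suc f)) (λ m → b m (j ∸ suc f)) g
      + nat (suc f) ^ α * conv (λ n → a n (j ∸ suc f)) (λ m → shifted σ f β 0 b m (j ∸ suc f)) g
      + nat (suc f) ^ β * conv (λ n → shifted ρ f α 0 a n (j ∸ suc f)) (λ m → b m (j ∸ suc f)) g
    collect f = begin
      Σ< (suc g) (H f) ≈⟨ trans (Σ<-+ (suc g) (λ n → H₁ f n + H₂ f n) (H₃ f)) (+-congʳ (Σ<-+ (suc g) (H₁ f) (H₂ f))) ⟩
      Σ< (suc g) (H₁ f) + Σ< (suc g) (H₂ f) + Σ< (suc g) (H₃ f)
        ≈⟨ +-cong (+-cong
             (trans (pull _ (λ n → a n (j ∸ suc f)) (λ m → b m (j ∸ suc f))) (*-congʳ (sym (^-homo-* (nat (suc f)) α β))))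
             (pull _ (λ n → a n (j ∸ suc f)) (λ m → shifted σ f β 0 b m (j ∸ suc f))))
             (pull _ (λ n → shifted ρ f α 0 a n (j ∸ suc f)) (λ m → b m (j ∸ suc f))) ⟩
      _ ∎

  -- A block that exceeds the common piece: `c` is the exponent of the piece, `p` that of the
  -- remainder, and `β` that of their sum, still to be expanded.
  mixed : (ℕ → Carrier) → (a b : ℕ → ℕ → Carrier) → ℕ → ℕ → ℕ → ℕ → ℕ × ℕ → Carrier
  mixed σ a b β p c f (g , i) = nat (suc f) ^ c * conv (λ n → a n i) (λ m → shifted σ f β p b m i) g

  -- Expanding (f + 1 + d)^β one factor at a time replaces the binomial theorem.
  span-mixed : ∀ σ (a b : ℕ → ℕ → Carrier) W →
    (∀ p → Span (cumulative ∘ top) (Admissible (W ℕ.+ p) 0)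
      (λ (g , i) → conv (λ n → a n i) (λ m → layer σ p b m i) g)) →
    ∀ β p c {μ} → μ ≤ c → Span top (Admissible (suc c ℕ.+ (W ℕ.+ (β ℕ.+ p))) μ) (outer (mixed σ a b β p c))
  span-mixed σ a b W spans zero p c μ≤c = span-cong
    (λ x → trans (outer-cong unshift x) (outer-prepend c k x))
    (prepend-cumulative μ≤c ℕ.≤-refl (spans p))
    where
    k : ℕ × ℕ → Carrier
    k (g , i) = conv (λ n → a n i) (λ m → layer σ p b m i) g
    unshift : ∀ f x → mixed σ a b 0 p c f x ≈ nat (suc f) ^ c * k x
    unshift f (g , i) = *-congˡ {x = nat (suc f) ^ c} (conv-cong {f = λ n → a n i} (λ _ → refl)
      (λ m → conv⁺-cong {ψ = λ e → nat (suc e) ^ p * σ m ^ suc e} {a = b m} (λ e → *-identityˡ _) (λ _ → refl) i) g)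
  span-mixed σ a b W spans (suc β) p c {μ} μ≤c = span-cong
    (λ x → trans (outer-cong split x) (outer-+ (mixed σ a b β p (suc c)) (mixed σ a b β (suc p) c) x))
    -- One unit of `β` passes to `c` or to `p`: the weight bound stays the same, and `c` never
    -- decreases, so that `μ ≤ c` persists.
    (span-+
      (span-mono (λ (l , v , le) → l , v , ℕ.≤-trans le (ℕ.≤-reflexive (weight₁ c W β p)))
        (span-mixed σ a b W spans β p (suc c) (ℕ.≤-trans μ≤c (ℕ.n≤1+n c))))
      (span-mono (λ (l , v , le) → l , v , ℕ.≤-trans le (ℕ.≤-reflexive (weight₂ c W β p)))
        (span-mixed σ a b W spans β (suc p) c μ≤c)))
    where
    weight₁ : ∀ c W β p → suc (suc c) ℕ.+ (W ℕ.+ (β ℕ.+ p)) ≡ suc c ℕ.+ (W ℕ.+ (suc β ℕ.+ p))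
    weight₁ = solve-∀
    weight₂ : ∀ c W β p → suc c ℕ.+ (W ℕ.+ (β ℕ.+ suc p)) ≡ suc c ℕ.+ (W ℕ.+ (suc β ℕ.+ p))
    weight₂ = solve-∀
    split : ∀ f x → mixed σ a b (suc β) p c f x ≈ mixed σ a b β p (suc c) f x + mixed σ a b β (suc p) c f x
    split f (g , i) = begin
      x * conv u (λ m → shifted σ f (suc β) p b m i) g
        ≈⟨ *-congˡ (conv-cong (λ _ → refl) step g) ⟩
      x * conv u (λ m → nat (suc f) * v m + v⁺ m) g
        ≈⟨ *-congˡ (trans (conv-distribˡ u _ v⁺ g) (+-congʳ (conv-*ʳ (nat (suc f)) u v g))) ⟩
      x * (nat (suc f) * conv u v g + conv u v⁺ g)
        ≈⟨ solve 4 (λ x y z w → x :* (y :* z :+ w) := y :* x :* z :+ x :* w) refl _ _ _ _ ⟩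
      nat (suc f) * x * conv u v g + x * conv u v⁺ g ∎
      where
      x = nat (suc f) ^ c
      u v v⁺ : ℕ → Carrier
      u n = a n i
      v m = shifted σ f β p b m i
      v⁺ m = shifted σ f β (suc p) b m i
      step : ∀ m → shifted σ f (suc β) p b m i ≈ nat (suc f) * v m + v⁺ m
      step m = begin
        shifted σ f (suc β) p b m i
          ≈⟨ conv⁺-cong (λ e → trans (*-congʳ (*-congʳ (nat-+ (suc f) (suc e))))
               (solve 5 (λ y z w k s → (y :+ z) :* w :* (k :* s) := y :* (w :* (k :* s)) :+ w :* (z :* k :* s))
                 refl _ _ _ _ _)) (λ _ → refl) i ⟩
        conv⁺ (λ e → nat (suc f) * ψ p e + ψ (suc p) e) (b m) i
          ≈⟨ trans (conv⁺-+ˡ _ _ (b m) i) (+-congʳ (conv⁺-*ˡ _ (ψ p) (b m) i)) ⟩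
        nat (suc f) * v m + v⁺ m ∎
        where
        ψ : ℕ → ℕ → Carrier
        ψ p e = nat (suc f ℕ.+ suc e) ^ β * (nat (suc e) ^ p * σ m ^ suc e)

  listWeight : List ℕ → ℕ
  listWeight []       = 0
  listWeight (α ∷ αs) = suc α ℕ.+ listWeight αs

  chain-0 : ∀ ρ α αs n → chain ρ (α ∷ αs) n 0 ≈ 0#
  chain-0 ρ α αs n = Σ<-0 n

  -- A chain without blocks has total length 0 and a chain with blocks has positive length, so the
  -- two never meet at the same `i`.
  conv-zero-at : ∀ {f g : ℕ → ℕ → Carrier} → (∀ n i → f n (suc i) ≈ 0#) → (∀ m → g m 0 ≈ 0#) →
                 ∀ n i → conv (λ n → f n i) (λ m → g m i) n ≈ 0#
  conv-zero-at {f} {g} f0 g0 n zero    =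
    trans (conv-comm (λ n → f n 0) (λ m → g m 0) n) (conv-zeroˡ (λ n → f n 0) g0 n)
  conv-zero-at {f} {g} f0 g0 n (suc i) = conv-zeroˡ _ (λ m → f0 m i) n

  module _ (ρ σ : ℕ → Carrier) (ρσ≈τ : ∀ n m → ρ n * σ m ≈ τ (n ℕ.+ m)) where

    product : ℕ → List ℕ → ℕ → List ℕ → ℕ × ℕ → Carrier
    product α αs β βs (g , j) =
      conv (λ n → layer ρ α (chain ρ αs) n j) (λ m → layer σ β (chain σ βs) m j) g

    -- Induction on the blocks, cutting at min(D, E). The exponent of the first piece is α + β, or
    -- at least α, or at least β, according to the case of `conv-layers`; this is why `μ` must bound
    -- both exponents from below. In the case D = E the variable v takes s = α + β + 1 of the
    -- available α + β + 2, and the unit left over pays for the factor u of the twofold sum.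
    span-product : ∀ α αs β βs {μ} → μ ≤ α → μ ≤ β →
      Span top (Admissible (listWeight (α ∷ αs) ℕ.+ listWeight (β ∷ βs)) μ) (product α αs β βs)
    span-product α αs β βs {μ} μ≤α μ≤β = span-cong
      (λ x → trans (conv-layers ρ σ ρσ≈τ α β (chain ρ αs) (chain σ βs) x)
        (trans (outer-+ (λ f y → diag f y + mixed σ (chain ρ αs) (chain σ βs) β 0 α f y) rest x)
          (+-cong
            (trans (outer-+ diag (mixed σ (chain ρ αs) (chain σ βs) β 0 α) x)
              (+-congʳ (outer-prepend (α ℕ.+ β) (both αs βs) x)))
            (outer-cong flip x))))
      (span-+ (span-+ (equal αs βs)
        (span-mono (λ (l , v , le) → l , v , ℕ.≤-trans le (ℕ.≤-reflexive (weight₁ α β (listWeight αs) (listWeight βs))))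
          (span-mixed σ (chain ρ αs) (chain σ βs) (suc (listWeight αs ℕ.+ listWeight βs)) (less αs) β 0 α μ≤α)))
        (span-mono (λ (l , v , le) → l , v , ℕ.≤-trans le (ℕ.≤-reflexive (weight₂ α β (listWeight αs) (listWeight βs))))
          (span-mixed ρ (chain σ βs) (chain ρ αs) (suc (listWeight αs ℕ.+ listWeight βs)) (greater βs) α 0 β μ≤β)))
      where
      both : List ℕ → List ℕ → ℕ × ℕ → Carrier
      both αs βs (g , i) = conv (λ n → chain ρ αs n i) (λ m → chain σ βs m i) g
      diag rest : ℕ → ℕ × ℕ → Carrier
      diag f x = nat (suc f) ^ (α ℕ.+ β) * both αs βs x
      rest f (g , i) = nat (suc f) ^ β * conv (λ n → shifted ρ f α 0 (chain ρ αs) n i) (λ m → chain σ βs m i) g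
      flip : ∀ f x → rest f x ≈ mixed ρ (chain σ βs) (chain ρ αs) α 0 β f x
      flip f (g , i) = *-congˡ {x = nat (suc f) ^ β}
        (conv-comm (λ n → shifted ρ f α 0 (chain ρ αs) n i) (λ m → chain σ βs m i) g)
      weight₁ : ∀ α β A B → suc α ℕ.+ (suc (A ℕ.+ B) ℕ.+ (β ℕ.+ 0)) ≡ suc α ℕ.+ A ℕ.+ (suc β ℕ.+ B)
      weight₁ = solve-∀
      weight₂ : ∀ α β A B → suc β ℕ.+ (suc (A ℕ.+ B) ℕ.+ (α ℕ.+ 0)) ≡ suc α ℕ.+ A ℕ.+ (suc β ℕ.+ B)
      weight₂ = solve-∀
      weight₃ : ∀ A B p → A ℕ.+ (suc p ℕ.+ B) ≡ suc (A ℕ.+ B) ℕ.+ p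
      weight₃ = solve-∀
      weight₄ : ∀ A B p → suc p ℕ.+ A ℕ.+ B ≡ suc (A ℕ.+ B) ℕ.+ p
      weight₄ = solve-∀
      weight₅ : ∀ α β → suc (α ℕ.+ β) ℕ.+ 1 ℕ.+ 0 ≡ suc α ℕ.+ 0 ℕ.+ (suc β ℕ.+ 0)
      weight₅ = solve-∀
      weight₆ : ∀ α β A B → suc (suc (α ℕ.+ β)) ℕ.+ (A ℕ.+ B) ≡ suc α ℕ.+ A ℕ.+ (suc β ℕ.+ B)
      weight₆ = solve-∀

      cumulate : ∀ {W h} → Span top (Admissible W 0) h → Span (cumulative ∘ top) (Admissible W 0) (cumulative h)
      cumulate = span-map cumulative-linear (λ _ → span-gen)

      -- After D < E the rest of the E-block stays at level m as a layer of exponent `p`, and only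
      -- the other side goes down to n′ < n. With no block left on that side, nothing can match the
      -- rest.
      less : ∀ αs p → Span (cumulative ∘ top) (Admissible (suc (listWeight αs ℕ.+ listWeight βs) ℕ.+ p) 0)
        (λ (g , i) → conv (λ n → chain ρ αs n i) (λ m → layer σ p (chain σ βs) m i) g)
      less [] p = span-cong
        (λ (g , i) → conv-zero-at {f = chain ρ []} {g = layer σ p (chain σ βs)} (λ _ _ → refl) (λ _ → refl) g i) span-0
      less (α′ ∷ αs′) p = span-cong
        (λ (g , i) → conv-Σ<ˡ (λ n → layer ρ α′ (chain ρ αs′) n i) (λ m → layer σ p (chain σ βs) m i) g)
        (span-mono (λ (l , v , le) → l , v , ℕ.≤-trans le (ℕ.≤-reflexive (weight₃ (listWeight (α′ ∷ αs′)) (listWeight βs) p)))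
          (cumulate {h = product α′ αs′ p βs} (span-product α′ αs′ p βs z≤n z≤n)))

      greater : ∀ βs p → Span (cumulative ∘ top) (Admissible (suc (listWeight αs ℕ.+ listWeight βs) ℕ.+ p) 0)
        (λ (g , i) → conv (λ m → chain σ βs m i) (λ n → layer ρ p (chain ρ αs) n i) g)
      greater [] p = span-cong
        (λ (g , i) → conv-zero-at {f = chain σ []} {g = layer ρ p (chain ρ αs)} (λ _ _ → refl) (λ _ → refl) g i) span-0
      greater (β′ ∷ βs′) p = span-cong
        (λ (g , i) → trans
          (conv-comm (λ m → chain σ (β′ ∷ βs′) m i) (λ n → layer ρ p (chain ρ αs) n i) g)
          (conv-Σ<ʳ (λ n → layer ρ p (chain ρ αs) n i) (λ m → layer σ β′ (chain σ βs′) m i) g))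
        (span-mono (λ (l , v , le) → l , v , ℕ.≤-trans le (ℕ.≤-reflexive (weight₄ (listWeight αs) (listWeight (β′ ∷ βs′)) p)))
          (cumulate {h = product p αs β′ βs′} (span-product p αs β′ βs′ z≤n z≤n)))

      -- There are g + 1 pairs of levels with n + m = g, and g + 1 is the value of u: an index thus
      -- ends in a pair with r = 1 when both chains end together.
      both-[] : ∀ g i → both [] [] (g , i) ≈ nat (suc g) ^ 1 * const 1# i
      both-[] g (suc i) = trans (conv-zeroˡ (λ _ → 0#) (λ _ → refl) g) (sym (zeroʳ _))
      both-[] g zero    = trans (ones g) (sym (trans (*-identityʳ _) (*-identityʳ _)))
        where
        ones : ∀ g → conv (λ _ → 1#) (λ _ → 1#) g ≈ nat (suc g)
        ones zero    = trans (*-identityˡ _) (sym ι-1)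
        ones (suc g) = trans (+-cong (*-identityˡ _) (ones g)) (sym (nat-suc (suc g)))

      -- After D = E the levels n′ < n and m′ < m go down independently, hence the twofold sum. If
      -- just one chain is exhausted, the lengths disagree and the term vanishes.
      equal : ∀ αs βs → Span top (Admissible (suc α ℕ.+ listWeight αs ℕ.+ (suc β ℕ.+ listWeight βs)) μ)
        (prepend (α ℕ.+ β) (both αs βs))
      equal [] [] = span-cong
        (λ (g , j) → trans (Linear.T-cong (prepend-linear (α ℕ.+ β)) (λ (g , i) → both-[] g i) (g , j))
          (conv⁺-*ʳ (nat (suc g) ^ 1) (λ d → nat (suc d) ^ (α ℕ.+ β) * τ g ^ suc d) (const 1#) j))
        (span-gen {i = (suc (α ℕ.+ β) , 1) , []}
          (s≤s (ℕ.≤-trans μ≤α (ℕ.m≤m+n α β)) , tt , ℕ.≤-reflexive (weight₅ α β)))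
      equal [] (β′ ∷ βs′) = span-cong
        (λ x → trans (Linear.T-cong (prepend-linear (α ℕ.+ β)) (λ (g , i) →
            conv-zero-at {f = chain ρ []} {g = chain σ (β′ ∷ βs′)} (λ _ _ → refl) (chain-0 σ β′ βs′) g i) x)
          (Linear.T-0 (prepend-linear (α ℕ.+ β)) x)) span-0
      equal (α′ ∷ αs′) [] = span-cong
        (λ x → trans (Linear.T-cong (prepend-linear (α ℕ.+ β)) (λ (g , i) → trans
            (conv-comm (λ n → chain ρ (α′ ∷ αs′) n i) (λ m → chain σ [] m i) g)
            (conv-zero-at {f = chain σ []} {g = chain ρ (α′ ∷ αs′)} (λ _ _ → refl) (chain-0 ρ α′ αs′) g i)) x)
          (Linear.T-0 (prepend-linear (α ℕ.+ β)) x)) span-0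
      equal (α′ ∷ αs′) (β′ ∷ βs′) = span-cong
        (Linear.T-cong (prepend-linear (α ℕ.+ β)) (λ (g , i) → trans
            (conv-Σ<ˡ (λ n → layer ρ α′ (chain ρ αs′) n i) (λ m → chain σ (β′ ∷ βs′) m i) g)
            (Σ<-cong g (conv-Σ<ʳ (λ n → layer ρ α′ (chain ρ αs′) n i) (λ m → layer σ β′ (chain σ βs′) m i)))))
        (prepend-cumulative² {h = product α′ αs′ β′ βs′} (ℕ.≤-trans μ≤α (ℕ.m≤m+n α β))
          (ℕ.≤-reflexive (weight₆ α β (listWeight (α′ ∷ αs′)) (listWeight (β′ ∷ βs′))))
          (span-product α′ αs′ β′ βs′ z≤n z≤n))

-- One factor of the infinite product as a power series in t.

module Geometric (R : Ring) where
  open FiniteSums R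
  open import Algebra.Properties.Semiring.Exp semiring using (_^_)
  open import Algebra.Properties.CommutativeSemiring.Exp commutativeSemiring using (^-distrib-*)

  -- 1 + r t  and  1 / (1 - r t)
  binomial geometric : Carrier → ℕ → Carrier
  binomial r zero    = 1#
  binomial r (suc n) = const r n
  geometric r n = r ^ n

  conv-geometric-suc : ∀ r s n →
    conv (geometric r) (geometric s) (suc n) ≈ s ^ suc n + r * conv (geometric r) (geometric s) n
  conv-geometric-suc r s n = +-cong (*-identityˡ _) (conv-*ˡ r (geometric r) (geometric s) n)

  conv-binomial-suc : ∀ r f n → conv (binomial r) f (suc n) ≈ f (suc n) + r * f n
  conv-binomial-suc r f n = +-cong (*-identityˡ _) (conv-const r f n)

  module _ {m₁ m₂ r₁ r₂} (m₁m₂≈r₁r₂ : m₁ * m₂ ≈ r₁ * r₂) where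
    private
      p g : ℕ → Carrier
      p = conv (geometric r₁) (geometric r₂)
      g = conv (binomial m₁) (conv (binomial m₂) p)

      recurrence : ∀ n → p (suc (suc n)) + (r₁ * r₂) * p n ≈ (r₁ + r₂) * p (suc n)
      recurrence n = begin
        p (suc (suc n)) + (r₁ * r₂) * p n
          ≈⟨ +-congʳ (conv-geometric-suc r₁ r₂ (suc n)) ⟩
        (r₂ * r₂ ^ suc n + r₁ * p (suc n)) + (r₁ * r₂) * p n
          ≈⟨ solve 5 (λ r s u v w → (s :* u :+ r :* v) :+ (r :* s) :* w := s :* (u :+ r :* w) :+ r :* v) refl _ _ _ _ _ ⟩
        r₂ * (r₂ ^ suc n + r₁ * p n) + r₁ * p (suc n)
          ≈⟨ +-congʳ (*-congˡ (conv-geometric-suc r₁ r₂ n)) ⟨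
        r₂ * p (suc n) + r₁ * p (suc n)
          ≈⟨ solve 3 (λ r s v → s :* v :+ r :* v := (r :+ s) :* v) refl _ _ _ ⟩
        (r₁ + r₂) * p (suc n) ∎

    ratio-zero : g 0 ≈ 1#
    ratio-zero = trans (*-identityˡ _) (trans (*-identityˡ _) (*-identityˡ _))

    -- Since m₁m₂ = r₁r₂, the quadratic terms agree: (1 + m₁t)(1 + m₂t) = (1 - r₁t)(1 - r₂t) + (r₁ +
    -- r₂ + m₁ + m₂)t. Division by (1 - r₁t)(1 - r₂t) leaves 1 plus a multiple of t times `p`.
    ratio-suc : ∀ n → g (suc n) ≈ (r₁ + r₂ + (m₁ + m₂)) * p n
    ratio-suc zero = begin
      g 1 ≈⟨ trans (conv-binomial-suc m₁ (conv (binomial m₂) p) 0) (+-cong (conv-binomial-suc m₂ p 0) (*-congˡ (*-identityˡ _))) ⟩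
      (p 1 + m₂ * p 0) + m₁ * p 0
        ≈⟨ +-congʳ (+-congʳ (trans (conv-geometric-suc r₁ r₂ 0) (+-congʳ (*-congˡ (sym (*-identityˡ _)))))) ⟩
      (r₂ * p 0 + r₁ * p 0 + m₂ * p 0) + m₁ * p 0
        ≈⟨ solve 5 (λ r s m l w → (s :* w :+ r :* w :+ l :* w) :+ m :* w := (r :+ s :+ (m :+ l)) :* w) refl _ _ _ _ _ ⟩
      (r₁ + r₂ + (m₁ + m₂)) * p 0 ∎
    ratio-suc (suc n) = begin
      g (suc (suc n))
        ≈⟨ trans (conv-binomial-suc m₁ _ (suc n)) (+-cong (conv-binomial-suc m₂ p (suc n)) (*-congˡ (conv-binomial-suc m₂ p n))) ⟩
      (p (suc (suc n)) + m₂ * p (suc n)) + m₁ * (p (suc n) + m₂ * p n)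
        ≈⟨ solve 5 (λ u v w m l → (u :+ l :* v) :+ m :* (v :+ l :* w) := (u :+ (m :* l) :* w) :+ (m :+ l) :* v) refl _ _ _ _ _ ⟩
      (p (suc (suc n)) + (m₁ * m₂) * p n) + (m₁ + m₂) * p (suc n)
        ≈⟨ +-congʳ (trans (+-congˡ (*-congʳ m₁m₂≈r₁r₂)) (recurrence n)) ⟩
      (r₁ + r₂) * p (suc n) + (m₁ + m₂) * p (suc n)
        ≈⟨ distribʳ _ _ _ ⟨
      (r₁ + r₂ + (m₁ + m₂)) * p (suc n) ∎

  -- The convolution is the complete homogeneous polynomial of degree n in the two ratios.
  conv-geometric-* : ∀ r s c n →
    conv (geometric (r * c)) (geometric (s * c)) n ≈ c ^ n * conv (geometric r) (geometric s) n
  conv-geometric-* r s c zero    = sym (*-identityˡ _)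
  conv-geometric-* r s c (suc n) = begin
    conv (geometric (r * c)) (geometric (s * c)) (suc n)
      ≈⟨ conv-geometric-suc (r * c) (s * c) n ⟩
    (s * c) ^ suc n + (r * c) * conv (geometric (r * c)) (geometric (s * c)) n
      ≈⟨ +-cong (^-distrib-* s c (suc n)) (*-congˡ (conv-geometric-* r s c n)) ⟩
    s ^ suc n * c ^ suc n + (r * c) * (c ^ n * p n)
      ≈⟨ solve 5 (λ u r c v p → u :* (c :* v) :+ (r :* c) :* (v :* p) := (c :* v) :* (u :+ r :* p)) refl _ _ _ _ _ ⟩
    c ^ suc n * (s ^ suc n + r * p n)
      ≈⟨ *-congˡ (conv-geometric-suc r s n) ⟨
    c ^ suc n * p (suc n) ∎
    where
    p : ℕ → Carrier
    p = conv (geometric r) (geometric s)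

  interchange₄ : ∀ a b c d a′ b′ c′ d′ →
    (((a * a′) * (b * b′)) * (c * c′)) * (d * d′) ≈ (((a * b) * c) * d) * (((a′ * b′) * c′) * d′)
  interchange₄ = solve 8 (λ a b c d a′ b′ c′ d′ →
    (((a :* a′) :* (b :* b′)) :* (c :* c′)) :* (d :* d′) := (((a :* b) :* c) :* d) :* (((a′ :* b′) :* c′) :* d′)) refl

  -- a tʲ
  monomial : ℕ → Carrier → ℕ → Carrier
  monomial zero    a         = const a
  monomial (suc j) a zero    = 0#
  monomial (suc j) a (suc d) = monomial j a d

  monomial-cong : ∀ j {a b} → a ≈ b → ∀ d → monomial j a d ≈ monomial j b d
  monomial-cong zero    e zero    = e
  monomial-cong zero    e (suc d) = refl
  monomial-cong (suc j) e zero    = refl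
  monomial-cong (suc j) e (suc d) = monomial-cong j e d

  *-monomial : ∀ a j b d → a * monomial j b d ≈ monomial j (a * b) d
  *-monomial a zero    b zero    = refl
  *-monomial a zero    b (suc d) = zeroʳ a
  *-monomial a (suc j) b zero    = zeroʳ a
  *-monomial a (suc j) b (suc d) = *-monomial a j b d

  conv-monomial : ∀ j a b d → conv (monomial j a) (monomial 1 b) d ≈ monomial (suc j) (a * b) d
  conv-monomial j a b d = trans (conv-comm (monomial j a) (monomial 1 b) d) (flipped d)
    where
    flipped : ∀ d → conv (monomial 1 b) (monomial j a) d ≈ monomial (suc j) (a * b) d
    flipped zero    = zeroˡ _
    flipped (suc d) = trans (+-congʳ (zeroˡ _)) (trans (+-identityˡ _)
      (trans (conv-const b (monomial j a) d) (trans (*-monomial b j a d) (monomial-cong j (*-comm b a) d))))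

  Σ<-monomial : ∀ (u : ℕ → Carrier) {N d} → d < N → Σ< N (λ j → monomial j (u j) d) ≈ u d
  Σ<-monomial u {suc N} {zero}  _         = trans (+-congˡ (Σ<-0 N)) (+-identityʳ _)
  Σ<-monomial u {suc N} {suc d} (s≤s d<N) = trans (+-identityˡ _) (Σ<-monomial (u ∘ suc) d<N)

  binomial-monomial : ∀ r d → const 1# d + - monomial 1 r d ≈ binomial (- r) d
  binomial-monomial r zero          = trans (+-congˡ -0#≈0#) (+-identityʳ _)
  binomial-monomial r (suc zero)    = +-identityˡ _
  binomial-monomial r (suc (suc d)) = trans (+-identityˡ _) -0#≈0#

  neg*neg : ∀ a b → (- a) * (- b) ≈ a * b
  neg*neg a b = begin
    (- a) * (- b)   ≈⟨ -‿distribˡ-* a (- b) ⟨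
    - (a * (- b))   ≈⟨ -‿cong (*-comm a (- b)) ⟩
    - ((- b) * a)   ≈⟨ -‿cong (-‿distribˡ-* b a) ⟨
    - (- (b * a))   ≈⟨ -‿involutive (b * a) ⟩
    b * a           ≈⟨ *-comm b a ⟩
    a * b           ∎
    where open import Algebra.Properties.Ring ring using (-‿involutive)

  private
    module ratio (x₁ x₂ c : Carrier) where
      m₁m₂≈r₁r₂ : (- (x₁ * x₂ * c)) * (- (1# * c)) ≈ (x₁ * c) * (x₂ * c)
      m₁m₂≈r₁r₂ = trans (neg*neg _ _) (trans (*-congˡ (*-identityˡ c))
        (solve 3 (λ x y c → (x :* y :* c) :* c := (x :* c) :* (y :* c)) refl x₁ x₂ c))

      assoc₄ : ∀ d → conv (conv (conv (binomial (- (x₁ * x₂ * c))) (binomial (- (1# * c)))) (geometric (x₁ * c))) (geometric (x₂ * c)) d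
        ≈ conv (binomial (- (x₁ * x₂ * c))) (conv (binomial (- (1# * c))) (conv (geometric (x₁ * c)) (geometric (x₂ * c)))) d
      assoc₄ d = trans (conv-assoc _ (geometric (x₁ * c)) (geometric (x₂ * c)) d)
        (conv-assoc (binomial (- (x₁ * x₂ * c))) (binomial (- (1# * c))) _ d)

  module _ (x₁ x₂ c : Carrier) where
    open ratio x₁ x₂ c

    factor-zero : conv (conv (conv (binomial (- (x₁ * x₂ * c))) (binomial (- (1# * c)))) (geometric (x₁ * c))) (geometric (x₂ * c)) 0 ≈ 1#
    factor-zero = trans (assoc₄ 0) (ratio-zero m₁m₂≈r₁r₂)

    factor-suc : ∀ d → conv (conv (conv (binomial (- (x₁ * x₂ * c))) (binomial (- (1# * c)))) (geometric (x₁ * c))) (geometric (x₂ * c)) (suc d)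
      ≈ c ^ suc d * ((x₁ + x₂ + (- (x₁ * x₂) + - 1#)) * conv (geometric x₁) (geometric x₂) d)
    factor-suc d = begin
      _ ≈⟨ trans (assoc₄ (suc d)) (ratio-suc m₁m₂≈r₁r₂ d) ⟩
      (x₁ * c + x₂ * c + (- (x₁ * x₂ * c) + - (1# * c))) * conv (geometric (x₁ * c)) (geometric (x₂ * c)) d
        ≈⟨ *-cong (+-congˡ (+-cong (-‿distribˡ-* _ _) (-‿distribˡ-* _ _))) (conv-geometric-* x₁ x₂ c d) ⟩
      (x₁ * c + x₂ * c + (- (x₁ * x₂) * c + - 1# * c)) * (c ^ d * conv (geometric x₁) (geometric x₂) d)
        ≈⟨ solve 7 (λ x y m n c e p → (x :* c :+ y :* c :+ (m :* c :+ n :* c)) :* (e :* p)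
             := (c :* e) :* ((x :+ y :+ (m :+ n)) :* p)) refl x₁ x₂ (- (x₁ * x₂)) (- 1#) c (c ^ d) _ ⟩
      _ ∎


-- Exponential series, binomial coefficients and power sums.

module Polynomials (S : Ring) (A : ℚ-Algebra S) where
  open Spans S A

  nat-0 : nat 0 ≈ 0#
  nat-0 = ι-0

  1/suc : ℕ → Carrier
  1/suc n = ι ((+ 1) ℚ./ suc n)

  1/suc-* : ∀ n x → 1/suc n * (nat (suc n) * x) ≈ x
  1/suc-* n x = trans (sym (*-assoc _ _ _)) (trans
    (*-congʳ (trans (sym (ι-* _ _)) (trans (reflexive (≡.cong ι (1/n*n≡1 (suc n)))) ι-1))) (*-identityˡ x))

  nat-cancel : ∀ n {x y} → nat (suc n) * x ≈ nat (suc n) * y → x ≈ y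
  nat-cancel n e = trans (sym (1/suc-* n _)) (trans (*-congˡ e) (1/suc-* n _))

  -- The Leibniz rule for the derivation t d/dt.
  conv-derivation : ∀ f g d →
    conv f (λ i → nat i * g i) d + conv (λ i → nat i * f i) g d ≈ nat d * conv f g d
  conv-derivation f g d = begin
    conv f (λ i → nat i * g i) d + conv (λ i → nat i * f i) g d
      ≈⟨ +-cong (conv-Σ< f _ d) (conv-Σ< _ g d) ⟩
    Σ< (suc d) (λ i → f i * (nat (d ∸ i) * g (d ∸ i))) + Σ< (suc d) (λ i → nat i * f i * g (d ∸ i))
      ≈⟨ Σ<-+ (suc d) (λ i → f i * (nat (d ∸ i) * g (d ∸ i))) (λ i → nat i * f i * g (d ∸ i)) ⟨
    Σ< (suc d) (λ i → f i * (nat (d ∸ i) * g (d ∸ i)) + nat i * f i * g (d ∸ i))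
      ≈⟨ Σ<-cong< (suc d) (λ { i (s≤s i≤d) → trans
           (solve 4 (λ f m g n → f :* (m :* g) :+ n :* f :* g := (n :+ m) :* (f :* g)) refl _ _ _ _)
           (*-congʳ {f i * g (d ∸ i)} (trans (sym (nat-+ i (d ∸ i))) (reflexive (≡.cong nat (ℕ.m+[n∸m]≡n i≤d))))) }) ⟩
    Σ< (suc d) (λ i → nat d * (f i * g (d ∸ i)))
      ≈⟨ Σ<-*ˡ (suc d) (nat d) (λ i → f i * g (d ∸ i)) ⟩
    nat d * Σ< (suc d) (λ i → f i * g (d ∸ i)) ≈⟨ *-congˡ (conv-Σ< f g d) ⟨
    nat d * conv f g d ∎

  exponential : Carrier → ℕ → Carrier
  exponential u b = u ^ b * ι (inv! b)

  exponential-suc : ∀ u b → nat (suc b) * exponential u (suc b) ≈ u * exponential u b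
  exponential-suc u b = trans
    (solve 4 (λ n u x k → n :* (u :* x :* k) := u :* (x :* (n :* k))) refl _ _ _ _)
    (*-congˡ (*-congˡ (trans (sym (ι-* _ _)) (reflexive (≡.cong ι (inv!-suc b))))))

  -- Both sides solve F′ = (u + v) F with the same constant term; coefficients are compared after
  -- multiplication by b + 1.
  exponential-+ : ∀ u v b → conv (exponential u) (exponential v) b ≈ exponential (u + v) b
  exponential-+ u v zero    = trans
    (*-cong (trans (*-identityˡ _) ι-1) refl) (*-identityˡ _)
  exponential-+ u v (suc b) = nat-cancel b (begin
    nat (suc b) * conv eu ev (suc b)
      ≈⟨ conv-derivation eu ev (suc b) ⟨
    conv eu (λ i → nat i * ev i) (suc b) + conv (λ i → nat i * eu i) ev (suc b)
      ≈⟨ +-cong (trans (conv-comm eu (λ i → nat i * ev i) (suc b)) (half v u)) (half u v) ⟩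
    v * conv ev eu b + u * conv eu ev b
      ≈⟨ +-congʳ (*-congˡ (conv-comm ev eu b)) ⟩
    v * conv eu ev b + u * conv eu ev b
      ≈⟨ solve 3 (λ u v c → v :* c :+ u :* c := (u :+ v) :* c) refl _ _ _ ⟩
    (u + v) * conv eu ev b
      ≈⟨ *-congˡ (exponential-+ u v b) ⟩
    (u + v) * exponential (u + v) b
      ≈⟨ exponential-suc (u + v) b ⟨
    nat (suc b) * exponential (u + v) (suc b) ∎)
    where
    eu ev : ℕ → Carrier
    eu = exponential u
    ev = exponential v
    half : ∀ u v → conv (λ i → nat i * exponential u i) (exponential v) (suc b) ≈ u * conv (exponential u) (exponential v) b
    half u v = begin
      nat 0 * exponential u 0 * exponential v (suc b) + conv (λ i → nat (suc i) * exponential u (suc i)) (exponential v) b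
        ≈⟨ +-cong (trans (*-congʳ (trans (*-congʳ nat-0) (zeroˡ _))) (zeroˡ _))
             (conv-cong (exponential-suc u) (λ _ → refl) b) ⟩
      0# + conv (λ i → u * exponential u i) (exponential v) b
        ≈⟨ trans (+-identityˡ _) (conv-*ˡ u _ _ b) ⟩
      u * conv (exponential u) (exponential v) b ∎

  -- The binomial coefficient C(i, k), defined through the hockey-stick identity, so that summation
  -- over i raises k by definition.
  choose : ℕ → ℕ → Carrier
  choose zero    i = 1#
  choose (suc k) i = Σ< i (choose k)

  -- This is (k + 1) C(i, k + 1) = (i - k) C(i, k) without subtraction. It serves in both
  -- directions: `span-nat^` passes from powers to binomial coefficients, `span-choose` passes back.
  choose-recurrence : ∀ k i → nat (suc k) * choose (suc k) i + nat k * choose k i ≈ nat i * choose k i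
  choose-recurrence zero    zero    =
    trans (+-congʳ (zeroʳ _)) (+-identityˡ _)
  choose-recurrence (suc k) zero    =
    trans (+-cong (zeroʳ _) (zeroʳ _)) (trans (+-identityˡ _) (sym (zeroʳ _)))
  choose-recurrence zero    (suc i) = begin
    nat 1 * Σ< (suc i) (choose 0) + nat 0 * 1# ≈⟨ +-congʳ (*-congˡ (Σ<-last i (choose 0))) ⟩
    nat 1 * (Σ< i (choose 0) + 1#) + nat 0 * 1#
      ≈⟨ solve 4 (λ n s u z → n :* (s :+ u) :+ z :* u := (n :* s :+ z :* u) :+ n :* u) refl _ _ _ _ ⟩
    (nat 1 * Σ< i (choose 0) + nat 0 * 1#) + nat 1 * 1# ≈⟨ +-congʳ (choose-recurrence zero i) ⟩
    nat i * 1# + nat 1 * 1# ≈⟨ distribʳ _ _ _ ⟨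
    (nat i + nat 1) * 1#    ≈⟨ *-congʳ (trans (+-comm _ _) (sym (nat-+ 1 i))) ⟩
    nat (suc i) * 1# ∎
  choose-recurrence (suc k) (suc i) = begin
    nat (suc (suc k)) * choose (suc (suc k)) (suc i) + nat (suc k) * choose (suc k) (suc i)
      ≈⟨ +-cong (*-congˡ (Σ<-last i (choose (suc k)))) (*-congˡ (Σ<-last i (choose k))) ⟩
    nat (suc (suc k)) * (c₂ + c₁) + nat (suc k) * (c₁ + c₀)
      ≈⟨ +-cong (trans (distribˡ _ _ _) (+-congˡ (*-congʳ (nat-suc (suc k))))) (*-congʳ (nat-suc k)) ⟩
    (nat (suc (suc k)) * c₂ + (1# + nat (suc k)) * c₁) + (1# + nat k) * (c₁ + c₀)
      ≈⟨ +-cong (+-congˡ (trans (distribʳ _ _ _) (+-congʳ (*-identityˡ _)))) (trans (distribʳ _ _ _) (+-congʳ (*-identityˡ _))) ⟩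
    (nat (suc (suc k)) * c₂ + (c₁ + nat (suc k) * c₁)) + ((c₁ + c₀) + nat k * (c₁ + c₀))
      ≈⟨ solve 5 (λ x c₁ y c₀ k → (x :+ (c₁ :+ y)) :+ ((c₁ :+ c₀) :+ k :* (c₁ :+ c₀))
           := (x :+ y) :+ ((c₁ :+ c₀) :+ ((c₁ :+ k :* c₁) :+ k :* c₀))) refl _ _ _ _ _ ⟩
    (nat (suc (suc k)) * c₂ + nat (suc k) * c₁) + ((c₁ + c₀) + ((c₁ + nat k * c₁) + nat k * c₀))
      ≈⟨ +-cong (choose-recurrence (suc k) i) (+-congˡ (trans
           (+-congʳ (trans (+-congʳ (sym (*-identityˡ c₁))) (trans (sym (distribʳ _ _ _)) (*-congʳ (sym (nat-suc k))))))
           (choose-recurrence k i))) ⟩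
    nat i * c₁ + ((c₁ + c₀) + nat i * c₀)
      ≈⟨ solve 3 (λ i c₁ c₀ → i :* c₁ :+ ((c₁ :+ c₀) :+ i :* c₀) := (c₁ :+ c₀) :+ i :* (c₁ :+ c₀)) refl _ _ _ ⟩
    (c₁ + c₀) + nat i * (c₁ + c₀)
      ≈⟨ trans (+-congʳ (sym (*-identityˡ _))) (sym (distribʳ _ _ _)) ⟩
    (1# + nat i) * (c₁ + c₀)
      ≈⟨ *-cong (nat-suc i) (Σ<-last i (choose k)) ⟨
    nat (suc i) * choose (suc k) (suc i) ∎
    where
    c₀ = choose k i
    c₁ = choose (suc k) i
    c₂ = choose (suc (suc k)) i

  multiply-linear : ∀ {X : Set} (m : X → Carrier) → Linear (λ f x → m x * f x)
  multiply-linear m = record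
    { T-cong = λ e x → *-congˡ (e x)
    ; T-+ = λ f g x → distribˡ _ _ _
    ; T-* = λ a f x → solve 3 (λ m a f → m :* (a :* f) := a :* (m :* f)) refl _ _ _
    }

  power : ℕ → ℕ → Carrier
  power α d = nat (suc d) ^ α

  Between : ℕ → ℕ → ℕ → Set
  Between l u α = l ≤ α × α ≤ u

  span-multiply : ∀ {l u f} → Span power (Between l u) f →
                  Span power (Between l (suc u)) (λ d → nat (suc d) * f d)
  span-multiply = span-map (multiply-linear (λ d → nat (suc d)))
    (λ α (l≤α , α≤u) → span-gen {i = suc α} (ℕ.≤-trans l≤α (ℕ.n≤1+n α) , s≤s α≤u))

  -- C(D, k + 1) vanishes at D = 0, so as a polynomial in D = d + 1 it has no constant term. The
  -- lower bound 1 recorded here is the source of s₁ > 1.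
  span-choose : ∀ k → Span power (Between 1 (suc k)) (λ d → choose (suc k) (suc d))
  span-choose zero = span-cong (λ d → begin
      choose 1 (suc d) ≈⟨ trans (*-congʳ ι-1) (*-identityˡ _) ⟨
      nat 1 * choose 1 (suc d) ≈⟨ trans (+-congˡ (trans (*-congʳ nat-0) (zeroˡ _))) (+-identityʳ _) ⟨
      nat 1 * choose 1 (suc d) + nat 0 * choose 0 (suc d) ≈⟨ choose-recurrence 0 (suc d) ⟩
      nat (suc d) * 1# ∎)
    (span-gen {i = 1} (ℕ.≤-refl , ℕ.≤-refl))
  span-choose (suc k) = span-cong (λ d → begin
      choose (suc (suc k)) (suc d) ≈⟨ 1/suc-* (suc k) _ ⟨
      1/suc (suc k) * (nat (suc (suc k)) * choose (suc (suc k)) (suc d))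
        ≈⟨ *-congˡ (trans (sym (+-identityʳ _)) (trans (+-congˡ (sym (-‿inverseʳ _))) (sym (+-assoc _ _ _)))) ⟩
      1/suc (suc k) * (nat (suc (suc k)) * choose (suc (suc k)) (suc d) + nat (suc k) * choose (suc k) (suc d)
        + - (nat (suc k) * choose (suc k) (suc d)))
        ≈⟨ *-congˡ (+-congʳ (choose-recurrence (suc k) (suc d))) ⟩
      _ ∎)
    (span-* ((+ 1) ℚ./ suc (suc k)) (span-+ (span-multiply (span-choose k))
      (span-mono (λ (l , u) → l , ℕ.≤-trans u (ℕ.n≤1+n _)) (span-neg (span-* (ℕ→ℚ (suc k)) (span-choose k))))))

  span-nat^ : ∀ b → Span choose (_≤ b) (λ i → nat i ^ b)
  span-nat^ zero    = span-gen {i = 0} z≤n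
  span-nat^ (suc b) = span-map (multiply-linear nat)
    (λ k k≤b → span-cong (λ i → sym (choose-recurrence k i))
      (span-+ (span-* (ℕ→ℚ (suc k)) (span-gen (s≤s k≤b))) (span-* (ℕ→ℚ k) (span-gen (ℕ.≤-trans k≤b (ℕ.n≤1+n b))))))
    (span-nat^ b)

  -- Faulhaber: the case c = 0 is the hockey-stick identity, and then d - i = (d + 1) - 1 - i raises c.
  span-power-conv : ∀ b c → Span power (Between 1 (suc (b ℕ.+ c))) (conv (λ i → nat i ^ b) (λ i → nat i ^ c))
  span-power-conv b zero    = span-cong
    (λ d → trans (conv-Σ< (λ i → nat i ^ b) (λ _ → 1#) d) (Σ<-cong (suc d) (λ i → *-identityʳ (nat i ^ b))))
    (span-map sums (λ k k≤b → span-mono (λ (l , u) → l , ℕ.≤-trans u (s≤s (ℕ.≤-trans k≤b (ℕ.m≤m+n b 0))))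
      (span-choose k)) (span-nat^ b))
    where
    sums : Linear (λ f d → Σ< (suc d) f)
    sums = record
      { T-cong = λ e d → Σ<-cong (suc d) e
      ; T-+ = λ f g d → Σ<-+ (suc d) f g
      ; T-* = λ a f d → Σ<-*ˡ (suc d) (ι a) f
      }
  span-power-conv b (suc c) = span-cong (λ d → begin
      conv nb (λ i → nat i * nc i) d
        ≈⟨ trans (sym (+-identityʳ _)) (trans (+-congˡ (sym (-‿inverseʳ _))) (sym (+-assoc _ _ _))) ⟩
      conv nb (λ i → nat i * nc i) d + conv (λ i → nat i * nb i) nc d + - conv (λ i → nat i * nb i) nc d
        ≈⟨ +-congʳ (conv-derivation nb nc d) ⟩
      nat d * conv nb nc d + - conv (λ i → nat i * nb i) nc d
        ≈⟨ +-congʳ (begin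
            nat d * conv nb nc d ≈⟨ +-identityʳ _ ⟨
            nat d * conv nb nc d + 0# ≈⟨ +-congˡ (-‿inverseʳ (conv nb nc d)) ⟨
            nat d * conv nb nc d + (conv nb nc d + - conv nb nc d) ≈⟨ +-assoc _ _ _ ⟨
            nat d * conv nb nc d + conv nb nc d + - conv nb nc d
              ≈⟨ +-congʳ (trans (+-comm _ _)
                (trans (+-congʳ (sym (*-identityˡ _))) (trans (sym (distribʳ _ _ _)) (*-congʳ (sym (nat-suc d)))))) ⟩
            nat (suc d) * conv nb nc d + - conv nb nc d ∎) ⟩
      nat (suc d) * conv nb nc d + - conv nb nc d + - conv (λ i → nat i * nb i) nc d ∎)
    (span-mono (λ (l , u) → l , ℕ.≤-trans u (ℕ.≤-reflexive (≡.cong suc (≡.sym (ℕ.+-suc b c)))))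
      (span-+ (span-+ (span-multiply (span-power-conv b c))
        (span-neg (span-mono (λ (l , u) → l , ℕ.≤-trans u (ℕ.n≤1+n _)) (span-power-conv b c))))
        (span-neg (span-power-conv (suc b) c))))
    where
    nb nc : ℕ → Carrier
    nb i = nat i ^ b
    nc i = nat i ^ c

-- The infinite product as a combination of chains.

module Expansion (S : Ring) (A : ℚ-Algebra S) (q : CommutativeRing.Carrier S) where
  open Chains S A q
  open Polynomials S A

  module Z = FiniteSums (Series S)
  module ZZ = FiniteSums (Series (Series S))
  module T = FiniteSums (Series (Series (Series S)))
  open import Algebra.Properties.Semiring.Exp ZZ.semiring using () renaming (_^_ to _^ᶻᶻ_)
  open Geometric (Series (Series S)) using (binomial; geometric; factor-zero; factor-suc)

  coeff₂ : ∀ f g b c → ZZ._*_ f g b c ≈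
    Σ< (suc b) (λ b′ → Σ< (suc c) (λ c′ → f b′ c′ * g (b ∸ b′) (c ∸ c′)))
  coeff₂ f g b c = trans (conv-coeff S f g b c) (Σ<-cong (suc b) (λ b′ → conv-Σ< (f b′) (g (b ∸ b′)) c))

  -- e^{z₁} and e^{z₂}
  x₁ x₂ : ZZ.Carrier
  x₁ b = const (exponential 1# b)
  x₂ = Z.const (exponential 1#)

  exponential-cong : ∀ {u v} → u ≈ v → ∀ b → exponential u b ≈ exponential v b
  exponential-cong e b = *-congʳ (^-congˡ b e)

  exponential-0 : ∀ b → const 1# b ≈ exponential (nat 0) b
  exponential-0 zero    = sym (trans (*-identityˡ _) ι-1)
  exponential-0 (suc b) = sym (trans (*-congʳ (trans (*-congʳ nat-0) (zeroˡ _))) (zeroˡ _))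

  exponential-step : ∀ i b → conv (exponential 1#) (exponential (nat i)) b ≈ exponential (nat (suc i)) b
  exponential-step i b = trans (exponential-+ 1# (nat i) b) (exponential-cong (sym (nat-suc i)) b)

  const-cong : ∀ {u v} → u ≈ v → ∀ n → const u n ≈ const v n
  const-cong e zero    = e
  const-cong e (suc n) = refl

  x₁^ : ∀ i → (x₁ ^ᶻᶻ i) ZZ.≈ (λ b → const (exponential (nat i) b))
  x₁^ zero    zero    c       = const-cong (exponential-0 0) c
  x₁^ zero    (suc b) zero    = exponential-0 (suc b)
  x₁^ zero    (suc b) (suc c) = refl
  x₁^ (suc i) b c = trans (ZZ.*-congˡ {x = x₁} (x₁^ i) b c)
    (trans (embed (exponential 1#) (exponential (nat i)) b c) (const-cong (exponential-step i b) c))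
    where
    embed : ∀ (f g : ℕ → Carrier) b c → Z.conv (λ b → const (f b)) (λ b → const (g b)) b c ≈ const (conv f g b) c
    embed f g zero    zero    = refl
    embed f g zero    (suc c) = trans (conv-const (f 0) (const (g 0)) (suc c)) (zeroʳ _)
    embed f g (suc b) zero    = +-congˡ (embed (f ∘ suc) g b zero)
    embed f g (suc b) (suc c) = trans
      (+-cong (trans (conv-const (f 0) (const (g (suc b))) (suc c)) (zeroʳ _)) (embed (f ∘ suc) g b (suc c)))
      (+-identityˡ _)

  x₂^ : ∀ i → (x₂ ^ᶻᶻ i) ZZ.≈ Z.const (exponential (nat i))
  x₂^ zero    zero    = exponential-0
  x₂^ zero    (suc b) c = refl
  x₂^ (suc i) b c = trans (ZZ.*-congˡ {x = x₂} (x₂^ i) b c)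
    (trans (Z.conv-const (exponential 1#) (Z.const (exponential (nat i))) b c) (merge b c))
    where
    merge : ∀ b c → conv (exponential 1#) (Z.const (exponential (nat i)) b) c ≈ Z.const (exponential (nat (suc i))) b c
    merge zero    c = exponential-step i c
    merge (suc b) c = trans (conv-comm (exponential 1#) (λ _ → 0#) c) (conv-zeroˡ _ (λ _ → refl) c)

  x₁x₂ : ∀ (f g : ℕ → Carrier) b c → ZZ._*_ (λ b → const (f b)) (Z.const g) b c ≈ f b * g c
  x₁x₂ f g b c = trans (ZZ.*-comm (λ b → const (f b)) (Z.const g) b c)
    (trans (Z.conv-const g (λ b → const (f b)) b c)
      (trans (conv-comm g (const (f b)) c) (conv-const (f b) g c)))

  homogeneous : ℕ → ZZ.Carrier
  homogeneous = ZZ.conv (geometric x₁) (geometric x₂)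

  homogeneous-coeff : ∀ d b c →
    homogeneous d b c ≈ ι (inv! b ℚ.* inv! c) * conv (λ i → nat i ^ b) (λ i → nat i ^ c) d
  homogeneous-coeff d b c = begin
    homogeneous d b c
      ≈⟨ trans (conv-coeff (Series S) (geometric x₁) (geometric x₂) d b c)
           (Σ<-coeff S (suc d) (λ i → (geometric x₁ i ZZ.* geometric x₂ (d ∸ i)) b) c) ⟩
    Σ< (suc d) (λ i → (geometric x₁ i ZZ.* geometric x₂ (d ∸ i)) b c)
      ≈⟨ Σ<-cong (suc d) (λ i → trans (ZZ.*-cong (x₁^ i) (x₂^ (d ∸ i)) b c) (x₁x₂ (exponential (nat i)) (exponential (nat (d ∸ i))) b c)) ⟩
    Σ< (suc d) (λ i → exponential (nat i) b * exponential (nat (d ∸ i)) c)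
      ≈⟨ Σ<-cong (suc d) (λ i → trans (solve 4 (λ x k y l → x :* k :* (y :* l) := (k :* l) :* (x :* y))
               refl (nat i ^ b) (ι (inv! b)) (nat (d ∸ i) ^ c) (ι (inv! c))) (*-congʳ (sym (ι-* (inv! b) (inv! c))))) ⟩
    Σ< (suc d) (λ i → ι (inv! b ℚ.* inv! c) * (nat i ^ b * nat (d ∸ i) ^ c))
      ≈⟨ trans (Σ<-*ˡ (suc d) _ (λ i → nat i ^ b * nat (d ∸ i) ^ c)) (*-congˡ (sym (conv-Σ< (λ i → nat i ^ b) (λ i → nat i ^ c) d))) ⟩
    _ ∎

  -- -(1 - x₁)(1 - x₂)
  y : ZZ.Carrier
  y = x₁ ZZ.+ x₂ ZZ.+ (ZZ.- (x₁ ZZ.* x₂) ZZ.+ ZZ.- ZZ.1#)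

  private
    cancel : ∀ {u v w} → v ≈ 0# → w ≈ u → u + v + (- w + - 0#) ≈ 0#
    cancel {u} {v} {w} v0 e = begin
      u + v + (- w + - 0#) ≈⟨ +-cong (trans (+-congˡ v0) (+-identityʳ _)) (trans (+-cong (-‿cong e) -0#≈0#) (+-identityʳ _)) ⟩
      u + - u              ≈⟨ -‿inverseʳ u ⟩
      0#                   ∎

    exponential-1-0 : exponential 1# 0 ≈ 1#
    exponential-1-0 = trans (*-identityˡ _) ι-1

  -- The factor 1 - x₁ is divisible by z₁; likewise 1 - x₂ by z₂ in `y-0ʳ`. So `y` uses up at least
  -- one power of each variable.
  y-0ˡ : ∀ c → y 0 c ≈ 0#
  y-0ˡ zero = begin
    e + e + (- (x₁ ZZ.* x₂) 0 0 + - 1#)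
      ≈⟨ +-cong (+-cong exponential-1-0 exponential-1-0) (+-congʳ (-‿cong (trans
           (x₁x₂ (exponential 1#) (exponential 1#) 0 0) (trans (*-cong exponential-1-0 exponential-1-0) (*-identityˡ 1#))))) ⟩
    1# + 1# + (- 1# + - 1#)
      ≈⟨ solve 2 (λ u v → u :+ u :+ (v :+ v) := (u :+ v) :+ (u :+ v)) refl 1# (- 1#) ⟩
    (1# + - 1#) + (1# + - 1#) ≈⟨ trans (+-cong (-‿inverseʳ 1#) (-‿inverseʳ 1#)) (+-identityˡ 0#) ⟩
    0# ∎
    where e = exponential 1# 0
  y-0ˡ (suc c) = trans (+-congʳ (+-comm _ _)) (cancel refl
    (trans (x₁x₂ (exponential 1#) (exponential 1#) 0 (suc c)) (trans (*-congʳ exponential-1-0) (*-identityˡ _))))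

  y-0ʳ : ∀ b → y b 0 ≈ 0#
  y-0ʳ zero    = y-0ˡ 0
  y-0ʳ (suc b) = cancel refl
    (trans (x₁x₂ (exponential 1#) (exponential 1#) (suc b) 0) (trans (*-congˡ exponential-1-0) (*-identityʳ _)))

  1^ : ∀ n → 1# ^ n ≈ 1#
  1^ zero    = refl
  1^ (suc n) = trans (*-identityˡ _) (1^ n)

  y-suc : ∀ b c → y (suc b) (suc c) ≈ ι (ℚ.- 1ℚ ℚ.* (inv! (suc b) ℚ.* inv! (suc c)))
  y-suc b c = begin
    0# + 0# + (- (x₁ ZZ.* x₂) (suc b) (suc c) + - 0#)
      ≈⟨ trans (+-cong (+-identityˡ 0#) (trans (+-congˡ -0#≈0#) (+-identityʳ _))) (+-identityˡ _) ⟩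
    - (x₁ ZZ.* x₂) (suc b) (suc c)
      ≈⟨ -‿cong (trans (x₁x₂ (exponential 1#) (exponential 1#) (suc b) (suc c)) (*-cong (unit (suc b)) (unit (suc c)))) ⟩
    - (ι (inv! (suc b)) * ι (inv! (suc c)))
      ≈⟨ ι-1*≈- _ ⟨
    ι (ℚ.- 1ℚ) * (ι (inv! (suc b)) * ι (inv! (suc c)))
      ≈⟨ trans (*-congˡ (sym (ι-* _ _))) (sym (ι-* _ _)) ⟩
    _ ∎
    where
    unit : ∀ n → exponential 1# n ≈ ι (inv! n)
    unit n = trans (*-congʳ (1^ n)) (*-identityˡ _)

  -- The coefficient of t^(d+1), not of t^d, in the factor with n = 0.
  γ : ℕ → ZZ.Carrier
  γ d = y ZZ.* homogeneous d

  Below : ℕ → ℕ → Set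
  Below w α = 1 ≤ α × suc α ≤ w

  -- At most z₁^(b-1) z₂^(c-1) is left for `homogeneous`, and the power sum raises the degree by 1:
  -- in all (b - 1) + (c - 1) + 1 < b + c. The strict inequality makes the weight α + 1 of a block
  -- fit into b + c.
  span-γ : ∀ b c → Span power (Below (b ℕ.+ c)) (λ d → γ d b c)
  span-γ b c = span-cong (λ d → coeff₂ y (homogeneous d) b c)
    (span-Σ< (suc b) (λ { b′ (s≤s b′≤b) → span-Σ< (suc c) (λ { c′ (s≤s c′≤c) → term b′ c′ b′≤b c′≤c }) }))
    where
    drop : ∀ {b c b′ c′} → suc b′ ≤ b → suc c′ ≤ c → suc (suc (b ∸ suc b′ ℕ.+ (c ∸ suc c′))) ≤ b ℕ.+ c
    drop {suc b} {suc c} {b′} {c′} (s≤s p) (s≤s r) = s≤s (ℕ.≤-trans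
      (s≤s (ℕ.+-mono-≤ (ℕ.m∸n≤m b b′) (ℕ.m∸n≤m c c′))) (ℕ.≤-reflexive (≡.sym (ℕ.+-suc b c))))
    term : ∀ b′ c′ → b′ ≤ b → c′ ≤ c →
      Span power (Below (b ℕ.+ c)) (λ d → y b′ c′ * homogeneous d (b ∸ b′) (c ∸ c′))
    term zero     c′       _ _ = span-cong (λ d → trans (*-congʳ (y-0ˡ c′)) (zeroˡ _)) span-0
    term (suc b′) zero     _ _ = span-cong (λ d → trans (*-congʳ (y-0ʳ (suc b′))) (zeroˡ _)) span-0
    term (suc b′) (suc c′) p r = span-cong
      (λ d → *-cong (y-suc b′ c′) (homogeneous-coeff d (b ∸ suc b′) (c ∸ suc c′)))
      (span-* (ℚ.- 1ℚ ℚ.* (inv! (suc b′) ℚ.* inv! (suc c′)))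
        (span-* (inv! (b ∸ suc b′) ℚ.* inv! (c ∸ suc c′))
        (span-mono (λ (l , u) → l , ℕ.≤-trans (s≤s u) (drop p r)) (span-power-conv (b ∸ suc b′) (c ∸ suc c′)))))

  scalar : Carrier → ZZ.Carrier
  scalar u = Z.const (const u)

  scalar-* : ∀ u f b c → (scalar u ZZ.* f) b c ≈ u * f b c
  scalar-* u f b c = trans (Z.conv-const (const u) f b c) (conv-const u (f b) c)

  ρ₀ : ℕ → Carrier
  ρ₀ n = q ^ n

  -- The factor (1 - x₁x₂tqⁿ)(1 - tqⁿ) / ((1 - x₁tqⁿ)(1 - x₂tqⁿ)) of the infinite product.
  factor : ℕ → T.Carrier
  factor n zero    = ZZ.1#
  factor n (suc d) = scalar (ρ₀ n ^ suc d) ZZ.* γ d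

  Q^ : ℕ → ZZ.Carrier
  Q^ n = scalar (q ^ n)

  scalar-^ : ∀ u d → (scalar u ^ᶻᶻ d) ZZ.≈ scalar (u ^ d)
  scalar-^ u zero    = ZZ.refl
  scalar-^ u (suc d) = ZZ.trans (ZZ.*-congˡ {scalar u} (scalar-^ u d)) step
    where
    step : (scalar u ZZ.* scalar (u ^ d)) ZZ.≈ scalar (u ^ suc d)
    step zero    zero    = scalar-* u (scalar (u ^ d)) 0 0
    step zero    (suc c) = trans (scalar-* u (scalar (u ^ d)) 0 (suc c)) (zeroʳ u)
    step (suc b) c       = trans (scalar-* u (scalar (u ^ d)) (suc b) c) (zeroʳ u)

  factor-ratio : ∀ n →
    (((binomial (ZZ.- (x₁ ZZ.* x₂ ZZ.* Q^ n)) T.* binomial (ZZ.- (ZZ.1# ZZ.* Q^ n)))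
      T.* geometric (x₁ ZZ.* Q^ n)) T.* geometric (x₂ ZZ.* Q^ n)) T.≈ factor n
  factor-ratio n zero    = factor-zero x₁ x₂ (Q^ n)
  factor-ratio n (suc d) = ZZ.trans (factor-suc x₁ x₂ (Q^ n) d) (ZZ.*-congʳ {γ d} (scalar-^ (q ^ n) (suc d)))

  -- Factors with index strictly below `n`, whereas `prodTo` includes its upper index; `prodTo` at N
  -- therefore corresponds to `partial (suc N)`.
  partial : ℕ → T.Carrier
  partial zero    = T.1#
  partial (suc n) = partial n T.* factor n

  chain₀ : List ℕ → ℕ × ℕ → Carrier
  chain₀ αs (n , j) = chain ρ₀ αs n j

  Light : ℕ → List ℕ → Set
  Light w αs = All (1 ≤_) αs × listWeight αs ≤ w

  -- For `power α` and `chain₀ αs` this is `chain₀ (α ∷ αs)`. Linearity in each argument lets the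
  -- length polynomial and the remaining product be expanded separately.
  append : (ℕ → Carrier) → (ℕ × ℕ → Carrier) → ℕ × ℕ → Carrier
  append φ h (N , j) = Σ< N (λ n → conv⁺ (λ d → φ d * ρ₀ n ^ suc d) (λ i → h (n , i)) j)

  append-linearˡ : ∀ h → Linear (λ φ → append φ h)
  append-linearˡ h = record
    { T-cong = λ e (N , j) → Σ<-cong N (λ n → conv⁺-cong (λ d → *-congʳ (e d)) (λ _ → refl) j)
    ; T-+ = λ φ ψ (N , j) → trans
        (Σ<-cong N (λ n → trans (conv⁺-cong (λ d → distribʳ _ _ _) (λ _ → refl) j)
          (conv⁺-+ˡ (λ d → φ d * ρ₀ n ^ suc d) (λ d → ψ d * ρ₀ n ^ suc d) (λ i → h (n , i)) j)))
        (Σ<-+ N (λ n → conv⁺ (λ d → φ d * ρ₀ n ^ suc d) (λ i → h (n , i)) j) (λ n → conv⁺ (λ d → ψ d * ρ₀ n ^ suc d) (λ i → h (n , i)) j))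
    ; T-* = λ a φ (N , j) → trans
        (Σ<-cong N (λ n → trans (conv⁺-cong (λ d → *-assoc _ _ _) (λ _ → refl) j)
          (conv⁺-*ˡ (ι a) (λ d → φ d * ρ₀ n ^ suc d) (λ i → h (n , i)) j)))
        (Σ<-*ˡ N (ι a) _)
    }

  append-linearʳ : ∀ φ → Linear (append φ)
  append-linearʳ φ = record
    { T-cong = λ e (N , j) → Σ<-cong N (λ n → L.T-cong n (λ i → e (n , i)) j)
    ; T-+ = λ f h (N , j) → trans (Σ<-cong N (λ n → L.T-+ n (λ i → f (n , i)) (λ i → h (n , i)) j)) (Σ<-+ N _ _)
    ; T-* = λ a h (N , j) → trans (Σ<-cong N (λ n → L.T-* n a (λ i → h (n , i)) j)) (Σ<-*ˡ N (ι a) _)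
    }
    where module L n = Linear (conv⁺-linear (λ d → φ d * ρ₀ n ^ suc d))

  private
    -- The change from `partial n` to `partial (suc n)`: factor n contributes a positive power of t,
    -- so that n is the highest level of the resulting chain.
    increment : ℕ → ℕ → ℕ → ℕ → Carrier
    increment b c n j = Σ< (suc b) (λ b′ → Σ< (suc c) (λ c′ →
      conv⁺ (λ d → γ d b′ c′ * ρ₀ n ^ suc d) (λ i → partial n i (b ∸ b′) (c ∸ c′)) j))

    increment-coeff : ∀ b c n j →
      ZZ.conv (λ d → factor n (suc d)) (partial n) j b c ≈ increment b c n (suc j)
    increment-coeff b c n j = begin
      ZZ.conv (λ d → factor n (suc d)) (partial n) j b c
        ≈⟨ trans (conv-coeff (Series S) (factor n ∘ suc) (partial n) j b c)
             (Σ<-coeff S (suc j) (λ d → (factor n (suc d) ZZ.* partial n (j ∸ d)) b) c) ⟩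
      Σ< (suc j) (λ d → (factor n (suc d) ZZ.* partial n (j ∸ d)) b c)
        ≈⟨ Σ<-cong (suc j) (λ d → trans (coeff₂ (factor n (suc d)) (partial n (j ∸ d)) b c)
             (Σ<-cong (suc b) (λ b′ → Σ<-cong (suc c) (λ c′ → *-congʳ {partial n (j ∸ d) (b ∸ b′) (c ∸ c′)}
               (trans (scalar-* (ρ₀ n ^ suc d) (γ d) b′ c′) (*-comm (ρ₀ n ^ suc d) (γ d b′ c′))))))) ⟩
      Σ< (suc j) (λ d → Σ< (suc b) (λ b′ → Σ< (suc c) (λ c′ → term d b′ c′)))
        ≈⟨ Σ<-swap (suc j) (suc b) (λ d b′ → Σ< (suc c) (λ c′ → term d b′ c′)) ⟩
      Σ< (suc b) (λ b′ → Σ< (suc j) (λ d → Σ< (suc c) (λ c′ → term d b′ c′)))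
        ≈⟨ Σ<-cong (suc b) (λ b′ → Σ<-swap (suc j) (suc c) (λ d c′ → term d b′ c′)) ⟩
      Σ< (suc b) (λ b′ → Σ< (suc c) (λ c′ → Σ< (suc j) (λ d → term d b′ c′)))
        ≈⟨ Σ<-cong (suc b) (λ b′ → Σ<-cong (suc c) (λ c′ →
             conv-Σ< (λ d → γ d b′ c′ * ρ₀ n ^ suc d) (λ i → partial n i (b ∸ b′) (c ∸ c′)) j)) ⟨
      increment b c n (suc j) ∎
      where
      term : ℕ → ℕ → ℕ → Carrier
      term d b′ c′ = (γ d b′ c′ * ρ₀ n ^ suc d) * partial n (j ∸ d) (b ∸ b′) (c ∸ c′)

    partial-suc : ∀ n j b c → partial (suc n) j b c ≈ partial n j b c + increment b c n j
    partial-suc n zero    b c = trans (T.*-comm (partial n) (factor n) 0 b c)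
      (trans (ZZ.*-identityˡ (partial n 0) b c) (sym (trans (+-congˡ
        (Σ<-zero (suc b) (λ b′ _ → Σ<-0 (suc c)))) (+-identityʳ _))))
    partial-suc n (suc j) b c = trans (T.*-comm (partial n) (factor n) (suc j) b c)
      (+-cong (ZZ.*-identityˡ (partial n (suc j)) b c) (increment-coeff b c n j))

    partial-sum : ∀ N j b c → partial N j b c ≈ T.1# j b c + Σ< N (λ n → increment b c n j)
    partial-sum zero    j b c = sym (+-identityʳ _)
    partial-sum (suc N) j b c = begin
      partial (suc N) j b c ≈⟨ trans (partial-suc N j b c) (+-congʳ (partial-sum N j b c)) ⟩
      T.1# j b c + Σ< N (λ n → increment b c n j) + increment b c N j
        ≈⟨ trans (+-assoc _ _ _) (+-congˡ (sym (Σ<-last N (λ n → increment b c n j)))) ⟩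
      T.1# j b c + Σ< (suc N) (λ n → increment b c n j) ∎

    sum-increment : ∀ b c N j → Σ< N (λ n → increment b c n j) ≈
      Σ< (suc b) (λ b′ → Σ< (suc c) (λ c′ →
        append (λ d → γ d b′ c′) (λ (n , i) → partial n i (b ∸ b′) (c ∸ c′)) (N , j)))
    sum-increment b c N j = trans (Σ<-swap N (suc b) (λ n b′ → Σ< (suc c) (term n b′)))
      (Σ<-cong (suc b) (λ b′ → Σ<-swap N (suc c) (λ n → term n b′)))
      where
      term : ℕ → ℕ → ℕ → Carrier
      term n b′ c′ = conv⁺ (λ d → γ d b′ c′ * ρ₀ n ^ suc d) (λ i → partial n i (b ∸ b′) (c ∸ c′)) j

    span-one : ∀ b c w → Span chain₀ (Light w) (λ (N , j) → T.1# j b c)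
    span-one zero    zero    w = span-cong (λ { (N , zero) → refl ; (N , suc j) → refl })
      (span-gen {i = []} ([] , z≤n))
    span-one zero    (suc c) w = span-cong (λ { (N , zero) → refl ; (N , suc j) → refl }) span-0
    span-one (suc b) c       w = span-cong (λ { (N , zero) → refl ; (N , suc j) → refl }) span-0

  -- Every block uses up degree in z₁ and z₂: a power α occurring in `γ` at b′, c′ satisfies α + 1 ≤
  -- b′ + c′, and the remaining product is needed at smaller degree only. The bound `k` on the
  -- degree makes the recursion structural.
  span-partial : ∀ k b c → b ℕ.+ c < k → Span chain₀ (Light (b ℕ.+ c)) (λ (N , j) → partial N j b c)
  span-partial (suc k) b c (s≤s b+c≤k) = span-cong
    (λ (N , j) → trans (partial-sum N j b c) (+-congˡ (sum-increment b c N j)))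
    (span-+ (span-one b c (b ℕ.+ c))
      (span-Σ< (suc b) (λ { b′ (s≤s b′≤b) → span-Σ< (suc c) (λ { c′ (s≤s c′≤c) →
        -- `γ` is expanded first: the inequality for its exponents shows that the recursive call is
        -- at smaller degree.
        span-map (append-linearˡ (λ (n , i) → partial n i (b ∸ b′) (c ∸ c′)))
          (λ α (1≤α , α<b′+c′) → span-map (append-linearʳ (power α))
            (λ αs (pos , light) → span-gen {i = α ∷ αs}
              ((1≤α ∷ pos) , ℕ.≤-trans (ℕ.+-mono-≤ α<b′+c′ light) (ℕ.≤-reflexive (split b′≤b c′≤c))))
            (span-partial k (b ∸ b′) (c ∸ c′) (ℕ.≤-trans
              (ℕ.≤-trans (ℕ.+-monoˡ-≤ _ (ℕ.≤-trans (s≤s z≤n) α<b′+c′)) (ℕ.≤-reflexive (split b′≤b c′≤c)))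
              b+c≤k)))
          (span-γ b′ c′) }) })))
    where
    split : ∀ {b c b′ c′} → b′ ≤ b → c′ ≤ c → b′ ℕ.+ c′ ℕ.+ (b ∸ b′ ℕ.+ (c ∸ c′)) ≡ b ℕ.+ c
    split {b} {c} {b′} {c′} p r = ≡.trans (interchange b′ c′ (b ∸ b′) (c ∸ c′))
      (≡.cong₂ ℕ._+_ (ℕ.m+[n∸m]≡n p) (ℕ.m+[n∸m]≡n r))
      where
      open import Data.Nat.Tactic.RingSolver using (solve-∀)
      interchange : ∀ a b c d → a ℕ.+ b ℕ.+ (c ℕ.+ d) ≡ a ℕ.+ c ℕ.+ (b ℕ.+ d)
      interchange = solve-∀

  -- The block has length at least 1. Hence high levels contribute high powers of q only, and the
  -- level sums may be truncated.
  layer-divisible : ∀ ρ α h n j → layer ρ α h n j ≈ ρ n * conv⁺ (λ d → nat (suc d) ^ α * ρ n ^ d) (h n) j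
  layer-divisible ρ α h n j = trans
    (conv⁺-cong (λ d → solve 3 (λ x r y → x :* (r :* y) := r :* (x :* y)) refl (nat (suc d) ^ α) (ρ n) (ρ n ^ d)) (λ _ → refl) j)
    (conv⁺-*ˡ (ρ n) (λ d → nat (suc d) ^ α * ρ n ^ d) (h n) j)

  rotate : ∀ a b c → a * (b * c) ≈ a * c * b
  rotate a b c = solve 3 (λ a b c → a :* (b :* c) := a :* c :* b) refl a b c

  -- Substituting t ↦ q t.
  chain-τ : ∀ βs n j → q ^ j * chain ρ₀ βs n j ≈ chain τ βs n j
  chain-τ []       n zero    = *-identityˡ 1#
  chain-τ []       n (suc j) = zeroʳ (q ^ suc j)
  chain-τ (β ∷ βs) n j = trans (sym (Σ<-*ˡ n (q ^ j) (λ n′ → layer ρ₀ β (chain ρ₀ βs) n′ j))) (Σ<-cong n layers)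
    where
    layers : ∀ n′ → q ^ j * layer ρ₀ β (chain ρ₀ βs) n′ j ≈ layer τ β (chain τ βs) n′ j
    layers n′ = begin
      q ^ j * layer ρ₀ β (chain ρ₀ βs) n′ j
        ≈⟨ *-congˡ {q ^ j} (conv⁺-Σ< _ (chain ρ₀ βs n′) j) ⟩
      q ^ j * Σ< j (λ d → nat (suc d) ^ β * ρ₀ n′ ^ suc d * chain ρ₀ βs n′ (j ∸ suc d))
        ≈⟨ Σ<-*ˡ j (q ^ j) (λ d → nat (suc d) ^ β * ρ₀ n′ ^ suc d * chain ρ₀ βs n′ (j ∸ suc d)) ⟨
      Σ< j (λ d → q ^ j * (nat (suc d) ^ β * ρ₀ n′ ^ suc d * chain ρ₀ βs n′ (j ∸ suc d)))
        ≈⟨ Σ<-cong< j entry ⟩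
      Σ< j (λ d → nat (suc d) ^ β * τ n′ ^ suc d * chain τ βs n′ (j ∸ suc d))
        ≈⟨ conv⁺-Σ< (λ d → nat (suc d) ^ β * τ n′ ^ suc d) (chain τ βs n′) j ⟨
      layer τ β (chain τ βs) n′ j ∎
      where
      entry : ∀ d → d < j → q ^ j * (nat (suc d) ^ β * ρ₀ n′ ^ suc d * chain ρ₀ βs n′ (j ∸ suc d))
        ≈ nat (suc d) ^ β * τ n′ ^ suc d * chain τ βs n′ (j ∸ suc d)
      entry d d<j = begin
        q ^ j * (N * R * C)
          -- The part q^(d+1) goes to the block and turns q^n′ into q^(n′+1); the rest goes to the
          -- remaining chain.
          ≈⟨ *-congʳ {N * R * C} (trans (reflexive (≡.cong (q ^_) (≡.sym (ℕ.m+[n∸m]≡n d<j)))) (^-homo-* q (suc d) (j ∸ suc d))) ⟩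
        (q ^ suc d * q ^ (j ∸ suc d)) * (N * R * C)
          ≈⟨ solve 5 (λ a b N R C → (a :* b) :* (N :* R :* C) := N :* (a :* R) :* (b :* C)) refl (q ^ suc d) (q ^ (j ∸ suc d)) N R C ⟩
        N * (q ^ suc d * R) * (q ^ (j ∸ suc d) * C)
          ≈⟨ *-cong (*-congˡ {N} (sym (^-distrib-* q (ρ₀ n′) (suc d)))) (chain-τ βs n′ (j ∸ suc d)) ⟩
        N * τ n′ ^ suc d * chain τ βs n′ (j ∸ suc d) ∎
        where
        N = nat (suc d) ^ β
        R = ρ₀ n′ ^ suc d
        C = chain ρ₀ βs n′ (j ∸ suc d)

  ρ₀τ≈τ : ∀ n m → ρ₀ n * τ m ≈ τ (n ℕ.+ m)
  ρ₀τ≈τ n m = trans (sym (^-homo-* q n (suc m))) (reflexive (≡.cong (q ^_) (ℕ.+-suc n m)))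

  next : ℕ × ℕ → ℕ × ℕ
  next (K , j) = suc K , j

  -- The power y^j of one factor meets (q/y)^j of the other, whence q^j. Through `next` the levels
  -- run up to K inclusive, as the coefficient of q^K requires.
  pair : (ℕ × ℕ → Carrier) → (ℕ × ℕ → Carrier) → ℕ × ℕ → Carrier
  pair f′ f x = q ^ proj₂ x * f′ (next x) * f (next x)

  pair-linear : ∀ f′ → Linear (pair f′)
  pair-linear f′ = linear-∘ (multiply-linear (λ x → q ^ proj₂ x * f′ (next x))) precompose
    where
    precompose : Linear (λ f x → f (next x))
    precompose = record
      { T-cong = λ e x → e (next x) ; T-+ = λ f g x → refl ; T-* = λ a f x → refl }

  pair-comm : ∀ f f′ x → pair f f′ x ≈ pair f′ f x
  pair-comm f f′ x = solve 3 (λ c a b → c :* a :* b := c :* b :* a) refl (q ^ proj₂ x) (f (next x)) (f′ (next x))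

-- Coefficients in ℚ[[q]] and the given bi-brackets.

module _ where
  module Q = FiniteSums ℚ-ring

  ℚ[[q]] : Ring
  ℚ[[q]] = Series ℚ-ring

  constants : ℚ-Algebra ℚ[[q]]
  constants = record
    { ι = Q.const
    ; ι-+ = λ { a b zero → ≡.refl ; a b (suc k) → ≡.refl }
    ; ι-* = λ { a b zero → ≡.refl ; a b (suc k) → ≡.sym (≡.trans (Q.conv-const a (Q.const b) (suc k)) (ℚ.*-zeroʳ a)) }
    ; ι-0 = λ { zero → ≡.refl ; (suc k) → ≡.refl }
    ; ι-1 = λ _ → ≡.refl
    }

  qVar : ℕ → ℚ
  qVar zero    = 0ℚ
  qVar (suc k) = Q.const 1ℚ k

  open Chains ℚ[[q]] constants qVar hiding (begin_; _∎; step-≡-⟩; step-≡-⟨)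
  open Polynomials ℚ[[q]] constants using (exponential)
  open Expansion ℚ[[q]] constants qVar

  Σ≤-Σ< : ∀ n f → Σ≤ n f ≡ Q.Σ< (suc n) f
  Σ≤-Σ< zero    f = ≡.sym (ℚ.+-identityʳ _)
  Σ≤-Σ< (suc n) f = ≡.trans (≡.cong (ℚ._+ f (suc n)) (Σ≤-Σ< n f)) (≡.sym (Q.Σ<-last (suc n) f))

  q-suc : ∀ f k → (qVar * f) (suc k) ≡ f k
  q-suc f k = ≡.trans (≡.cong (ℚ._+ Q.conv (Q.const 1ℚ) f k) (ℚ.*-zeroˡ (f (suc k))))
    (≡.trans (ℚ.+-identityˡ _) (≡.trans (Q.conv-const 1ℚ f k) (ℚ.*-identityˡ (f k))))

  q^-≥ : ∀ e f {k} → e ≤ k → (qVar ^ e * f) k ≡ f (k ∸ e)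
  q^-≥ zero    f {k} z≤n = *-identityˡ f k
  q^-≥ (suc e) f {suc k} (s≤s e≤k) =
    ≡.trans (*-assoc qVar (qVar ^ e) f (suc k)) (≡.trans (q-suc (qVar ^ e * f) k) (q^-≥ e f e≤k))

  q^-< : ∀ e f {k} → k < e → (qVar ^ e * f) k ≡ 0ℚ
  q^-< (suc e) f {zero}  k<e       = ≡.trans (*-assoc qVar (qVar ^ e) f 0) (ℚ.*-zeroˡ ((qVar ^ e * f) 0))
  q^-< (suc e) f {suc k} (s≤s k<e) =
    ≡.trans (*-assoc qVar (qVar ^ e) f (suc k)) (≡.trans (q-suc (qVar ^ e * f) k) (q^-< e f k<e))

  nat^ : ∀ n a → nat n ^ a ≈ ι (ℕ→ℚ (n ℕ.^ a))
  nat^ n zero    = λ _ → ≡.refl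
  nat^ n (suc a) = trans (*-congˡ {nat n} (nat^ n a))
    (trans (sym (ι-* (ℕ→ℚ n) (ℕ→ℚ (n ℕ.^ a)))) (λ k → ≡.cong (λ x → ι x k) (≡.sym (ℕ→ℚ-* n (n ℕ.^ a)))))

  Σ<-antidiagonal : ∀ J (h : ℕ → ℕ → ℚ) →
    Q.Σ< J (λ j → Q.Σ< j (λ d → h d (j ∸ suc d))) ≡ Q.Σ< J (λ d → Q.Σ< (J ∸ suc d) (h d))
  Σ<-antidiagonal zero    h = ≡.refl
  Σ<-antidiagonal (suc J) h = ≡.trans (ℚ.+-identityˡ _)
    (≡.trans (Q.Σ<-+ J (h 0) (λ j → Q.Σ< j (λ d → h (suc d) (j ∸ suc d))))
      (≡.cong (Q.Σ< J (h 0) ℚ.+_) (Σ<-antidiagonal J (h ∘ suc))))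

  factorials : BiIdx → ℚ
  factorials []            = 1ℚ
  factorials ((s , r) ∷ L) = ℕ→ℚ (r !) ℚ.* ℕ→ℚ ((s ∸ 1) !) ℚ.* factorials L

  n!*inv! : ∀ n → ℕ→ℚ (n !) ℚ.* inv! n ≡ 1ℚ
  n!*inv! n = ≡.trans (ℚ.*-comm (ℕ→ℚ (n !)) (inv! n)) (1/n*n≡1 (n !) {{n ℕ.!≢0}})

  δ-0 : ∀ n → δ n 0 ≡ Q.const 1ℚ n
  δ-0 zero    = ≡.refl
  δ-0 (suc n) = ≡.refl

  ≤ᵇ-true : ∀ {m n} → m ≤ n → (m ≤ᵇ n) ≡ true
  ≤ᵇ-true {m} {n} m≤n with m ≤ᵇ n | ℕ.≤⇒≤ᵇ m≤n
  ... | true | _ = ≡.refl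

  ≤ᵇ-false : ∀ {m n} → n < m → (m ≤ᵇ n) ≡ false
  ≤ᵇ-false {m} {n} n<m with m ≤ᵇ n | ℕ.≤ᵇ⇒≤ m n
  ... | false | _ = ≡.refl
  ... | true  | p = contradiction (p tt) (ℕ.<⇒≱ n<m)

  private
    summand : ℕ → ℕ → BiIdx → ℕ → ℕ → ℕ → ℚ
    summand s r L N u v = (ℕ→ℚ (u ℕ.^ r) ℚ.* inv! r) ℚ.* (ℕ→ℚ (v ℕ.^ (s ∸ 1)) ℚ.* inv! (s ∸ 1))
      ℚ.* bbCoeff L (N ∸ u ℕ.* v) u

  -- The boundary terms u = 0, u = B + 1 and v = 0 are killed by the Boolean guards; the others are
  -- numbered by u = g + 1 and v = f + 1.
  bbCoeff-Σ< : ∀ s r L N B → bbCoeff ((s , r) ∷ L) N (suc B) ≡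
    Q.Σ< B (λ g → Q.Σ< N (λ f → if suc g ℕ.* suc f ≤ᵇ N then summand s r L N (suc g) (suc f) else 0ℚ))
  bbCoeff-Σ< s r L N B = begin
    bbCoeff ((s , r) ∷ L) N (suc B)
      ≡⟨ ≡.trans (Σ≤-Σ< (suc B) (λ u → Σ≤ N (term u))) (Q.Σ<-cong (suc (suc B)) (λ u → Σ≤-Σ< N (term u))) ⟩
    Q.Σ< (suc N) (term 0) ℚ.+ Q.Σ< (suc B) (λ g → Q.Σ< (suc N) (term (suc g)))
      ≡⟨ ≡.trans (≡.cong (ℚ._+ Q.Σ< (suc B) (λ g → Q.Σ< (suc N) (term (suc g)))) (Q.Σ<-0 (suc N))) (ℚ.+-identityˡ _) ⟩
    Q.Σ< (suc B) (λ g → Q.Σ< (suc N) (term (suc g)))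
      ≡⟨ Q.Σ<-last B (λ g → Q.Σ< (suc N) (term (suc g))) ⟩
    Q.Σ< B (λ g → Q.Σ< (suc N) (term (suc g))) ℚ.+ Q.Σ< (suc N) (term (suc B))
      ≡⟨ ≡.cong₂ ℚ._+_
           (Q.Σ<-cong< B (λ g g<B → ≡.trans (Q.+-cong (small g g<B 0) (Q.Σ<-cong N (λ f → small g g<B (suc f)))) (ℚ.+-identityˡ (Q.Σ< N (cut g)))))
           (Q.Σ<-zero (suc N) (λ v _ → large v)) ⟩
    Q.Σ< B (λ g → Q.Σ< N (cut g)) ℚ.+ 0ℚ ≡⟨ ℚ.+-identityʳ _ ⟩
    Q.Σ< B (λ g → Q.Σ< N (cut g)) ∎
    where
    open ≡.≡-Reasoning
    term : ℕ → ℕ → ℚ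
    term u v = if (1 ≤ᵇ u) ∧ (suc u ≤ᵇ suc B) ∧ (1 ≤ᵇ v) ∧ (u ℕ.* v ≤ᵇ N) then summand s r L N u v else 0ℚ
    cut : ℕ → ℕ → ℚ
    cut g f = if suc g ℕ.* suc f ≤ᵇ N then summand s r L N (suc g) (suc f) else 0ℚ
    small : ∀ g → g < B → ∀ v → term (suc g) v ≡ (if (1 ≤ᵇ v) ∧ (suc g ℕ.* v ≤ᵇ N) then summand s r L N (suc g) v else 0ℚ)
    small g g<B v = ≡.cong (λ c → if c ∧ (1 ≤ᵇ v) ∧ (suc g ℕ.* v ≤ᵇ N) then summand s r L N (suc g) v else 0ℚ)
      (≤ᵇ-true {suc (suc g)} {suc B} (s≤s g<B))
    large : ∀ v → term (suc B) v ≡ 0ℚ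
    large v = ≡.cong (λ c → if c ∧ (1 ≤ᵇ v) ∧ (suc B ℕ.* v ≤ᵇ N) then summand s r L N (suc B) v else 0ℚ)
      (≤ᵇ-false {suc (suc B)} {suc B} ℕ.≤-refl)

  -- Since u, v ≥ 1, the condition v₁ + ⋯ + v_ℓ < J is implied by u₁v₁ + ⋯ + u_ℓv_ℓ = N < J.
  brackets-bbCoeff : ∀ L N B J → N < J →
    Q.Σ< J (λ j → brackets L B j N) ≡ factorials L ℚ.* bbCoeff L N (suc B)
  brackets-bbCoeff [] N B (suc J) _ = begin
    Q.const 1ℚ N ℚ.+ Q.Σ< J (λ _ → 0ℚ) ≡⟨ ≡.cong (Q.const 1ℚ N ℚ.+_) (Q.Σ<-0 J) ⟩
    Q.const 1ℚ N ℚ.+ 0ℚ               ≡⟨ ℚ.+-identityʳ _ ⟩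
    Q.const 1ℚ N                      ≡⟨ δ-0 N ⟨
    δ N 0                             ≡⟨ ℚ.*-identityˡ _ ⟨
    1ℚ ℚ.* δ N 0                      ∎
    where open ≡.≡-Reasoning
  brackets-bbCoeff ((s , r) ∷ L) N B J N<J = begin
    Q.Σ< J (λ j → brackets ((s , r) ∷ L) B j N)
      ≡⟨ Q.Σ<-cong J (λ j → ≡.trans (Σ<-coeff ℚ-ring B (λ g → nat (suc g) ^ r * layer τ a (brackets L) g j) N)
           (Q.Σ<-cong B (λ g → coefficient g j))) ⟩
    Q.Σ< J (λ j → Q.Σ< B (λ g → Q.Σ< j (λ f → entry g f (j ∸ suc f))))
      ≡⟨ Q.Σ<-swap J B (λ j g → Q.Σ< j (λ f → entry g f (j ∸ suc f))) ⟩
    Q.Σ< B (λ g → Q.Σ< J (λ j → Q.Σ< j (λ f → entry g f (j ∸ suc f))))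
      ≡⟨ Q.Σ<-cong B (λ g → ≡.trans (Σ<-antidiagonal J (entry g)) (Q.Σ<-cong J (collapse g))) ⟩
    Q.Σ< B (λ g → Q.Σ< J (λ f → F ℚ.* cut g f))
      ≡⟨ Q.Σ<-cong B (λ g → ≡.trans (Q.Σ<-extend (λ f → F ℚ.* cut g f) (ℕ.<⇒≤ N<J) (beyond g)) (Q.Σ<-*ˡ N F (cut g))) ⟩
    Q.Σ< B (λ g → F ℚ.* Q.Σ< N (cut g)) ≡⟨ Q.Σ<-*ˡ B F (λ g → Q.Σ< N (cut g)) ⟩
    F ℚ.* Q.Σ< B (λ g → Q.Σ< N (cut g)) ≡⟨ ≡.cong (F ℚ.*_) (bbCoeff-Σ< s r L N B) ⟨
    F ℚ.* bbCoeff ((s , r) ∷ L) N (suc B) ∎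
    where
    open ≡.≡-Reasoning
    a : ℕ
    a = s ∸ 1
    F : ℚ
    F = factorials ((s , r) ∷ L)
    cut : ℕ → ℕ → ℚ
    cut g f = if suc g ℕ.* suc f ≤ᵇ N then summand s r L N (suc g) (suc f) else 0ℚ
    entry : ℕ → ℕ → ℕ → ℚ
    entry g f i = ℕ→ℚ (suc g ℕ.^ r) ℚ.* (ℕ→ℚ (suc f ℕ.^ a) ℚ.* (qVar ^ (suc g ℕ.* suc f) * brackets L g i) N)

    coefficient : ∀ g j → (nat (suc g) ^ r * layer τ a (brackets L) g j) N ≡ Q.Σ< j (λ f → entry g f (j ∸ suc f))
    coefficient g j = begin
      (nat (suc g) ^ r * layer τ a (brackets L) g j) N
        ≡⟨ ≡.trans (*-congʳ {layer τ a (brackets L) g j} (nat^ (suc g) r) N) (Q.conv-const _ (layer τ a (brackets L) g j) N) ⟩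
      u ℚ.* layer τ a (brackets L) g j N
        ≡⟨ ≡.cong (u ℚ.*_) (≡.trans (conv⁺-Σ< (λ f → nat (suc f) ^ a * τ g ^ suc f) (brackets L g) j N)
             (Σ<-coeff ℚ-ring j (λ f → nat (suc f) ^ a * τ g ^ suc f * brackets L g (j ∸ suc f)) N)) ⟩
      u ℚ.* Q.Σ< j (λ f → (nat (suc f) ^ a * τ g ^ suc f * brackets L g (j ∸ suc f)) N)
        ≡⟨ ≡.cong (u ℚ.*_) (Q.Σ<-cong j (λ f → single f (brackets L g (j ∸ suc f)))) ⟩
      u ℚ.* Q.Σ< j (λ f → ℕ→ℚ (suc f ℕ.^ a) ℚ.* (qVar ^ (suc g ℕ.* suc f) * brackets L g (j ∸ suc f)) N)
        ≡⟨ Q.Σ<-*ˡ j u _ ⟨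
      Q.Σ< j (λ f → entry g f (j ∸ suc f)) ∎
      where
      u = ℕ→ℚ (suc g ℕ.^ r)
      single : ∀ f h → (nat (suc f) ^ a * τ g ^ suc f * h) N ≡ ℕ→ℚ (suc f ℕ.^ a) ℚ.* (qVar ^ (suc g ℕ.* suc f) * h) N
      single f h = ≡.trans (*-assoc (nat (suc f) ^ a) (τ g ^ suc f) h N)
        (≡.trans (*-cong (nat^ (suc f) a) (*-congʳ {h} (^-assocʳ qVar (suc g) (suc f))) N) (Q.conv-const _ _ N))

    collapse : ∀ g f → Q.Σ< (J ∸ suc f) (entry g f) ≡ F ℚ.* cut g f
    collapse g f with (suc g ℕ.* suc f) ℕ.≤? N
    ... | no uv≰N = ≡.trans (Q.Σ<-zero (J ∸ suc f) (λ i _ → ≡.trans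
          (≡.cong (λ x → ℕ→ℚ (suc g ℕ.^ r) ℚ.* (ℕ→ℚ (suc f ℕ.^ a) ℚ.* x)) (q^-< (suc g ℕ.* suc f) (brackets L g i) (ℕ.≰⇒> uv≰N)))
          (≡.trans (≡.cong (ℕ→ℚ (suc g ℕ.^ r) ℚ.*_) (ℚ.*-zeroʳ (ℕ→ℚ (suc f ℕ.^ a)))) (ℚ.*-zeroʳ (ℕ→ℚ (suc g ℕ.^ r))))))
        (≡.sym (≡.trans (≡.cong (λ c → F ℚ.* (if c then summand s r L N (suc g) (suc f) else 0ℚ))
          (≤ᵇ-false {suc g ℕ.* suc f} {N} (ℕ.≰⇒> uv≰N))) (ℚ.*-zeroʳ F)))
    ... | yes uv≤N = begin
      Q.Σ< (J ∸ suc f) (entry g f)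
        ≡⟨ Q.Σ<-cong (J ∸ suc f) (λ i → ≡.cong (λ x → U ℚ.* (V ℚ.* x)) (q^-≥ (suc g ℕ.* suc f) (brackets L g i) uv≤N)) ⟩
      Q.Σ< (J ∸ suc f) (λ i → U ℚ.* (V ℚ.* brackets L g i N′))
        ≡⟨ ≡.trans (Q.Σ<-*ˡ (J ∸ suc f) U _) (≡.cong (U ℚ.*_) (Q.Σ<-*ˡ (J ∸ suc f) V _)) ⟩
      U ℚ.* (V ℚ.* Q.Σ< (J ∸ suc f) (λ i → brackets L g i N′))
        ≡⟨ ≡.cong (λ x → U ℚ.* (V ℚ.* x)) (brackets-bbCoeff L N′ g (J ∸ suc f) N′<J′) ⟩
      U ℚ.* (V ℚ.* (factorials L ℚ.* bb))
        ≡⟨ ≡.trans (≡.cong₂ ℚ._*_ (n!*inv! r) (≡.cong (ℚ._* (U ℚ.* (V ℚ.* (factorials L ℚ.* bb)))) (n!*inv! a)))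
             (≡.trans (ℚ.*-identityˡ _) (ℚ.*-identityˡ _)) ⟨
      (ℕ→ℚ (r !) ℚ.* inv! r) ℚ.* ((ℕ→ℚ (a !) ℚ.* inv! a) ℚ.* (U ℚ.* (V ℚ.* (factorials L ℚ.* bb))))
        ≡⟨ Q.solve 8 (λ r! ir a! ia U V fL bb → (r! Q.:* ir) Q.:* ((a! Q.:* ia) Q.:* (U Q.:* (V Q.:* (fL Q.:* bb))))
              Q.:= (r! Q.:* a! Q.:* fL) Q.:* ((U Q.:* ir) Q.:* (V Q.:* ia) Q.:* bb)) ≡.refl
              (ℕ→ℚ (r !)) (inv! r) (ℕ→ℚ (a !)) (inv! a) U V (factorials L) bb ⟩
      F ℚ.* summand s r L N (suc g) (suc f)
        ≡⟨ ≡.cong (λ c → F ℚ.* (if c then summand s r L N (suc g) (suc f) else 0ℚ)) (≤ᵇ-true uv≤N) ⟨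
      F ℚ.* cut g f ∎
      where
      U = ℕ→ℚ (suc g ℕ.^ r)
      V = ℕ→ℚ (suc f ℕ.^ a)
      N′ = N ∸ suc g ℕ.* suc f
      bb = bbCoeff L N′ (suc g)
      -- As v ≤ uv, the bound is inherited: N - uv < J - uv ≤ J - v.
      N′<J′ : N′ < J ∸ suc f
      N′<J′ = ℕ.<-≤-trans (ℕ.∸-monoˡ-< N<J uv≤N) (ℕ.∸-monoʳ-≤ J (ℕ.m≤m+n (suc f) (g ℕ.* suc f)))

    beyond : ∀ g f → N ≤ f → F ℚ.* cut g f ≡ 0ℚ
    beyond g f N≤f = ≡.trans (≡.cong (λ c → F ℚ.* (if c then summand s r L N (suc g) (suc f) else 0ℚ))
      (≤ᵇ-false {suc g ℕ.* suc f} {N} (ℕ.≤-trans (s≤s N≤f) (ℕ.m≤m+n (suc f) (g ℕ.* suc f))))) (ℚ.*-zeroʳ F)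

  -- The given product as an iterated power series, modulo powers of q.

  open Geometric (Series (Series ℚ[[q]])) hiding (interchange₄)
  open Geometric (Series (Series (Series ℚ[[q]]))) using (interchange₄)
  open import Algebra.Properties.Semiring.Exp ZZ.semiring using () renaming (_^_ to _^ᶻᶻ_)

  -- The variables in the order t, z₁, z₂, q.
  reorder : PS → T.Carrier
  reorder f j b c k = f k j b c

  T-coeff : ∀ f g j b c k → (f T.* g) j b c k ≡
    Q.Σ< (suc j) (λ j′ → Q.Σ< (suc b) (λ b′ → Q.Σ< (suc c) (λ c′ → Q.Σ< (suc k) (λ k′ →
      f j′ b′ c′ k′ ℚ.* g (j ∸ j′) (b ∸ b′) (c ∸ c′) (k ∸ k′)))))
  T-coeff f g j b c k = ≡.trans
    (≡.trans (conv-coeff (Series ℚ[[q]]) f g j b c k)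
      (≡.trans (Σ<-coeff ℚ[[q]] (suc j) (λ j′ → (f j′ ZZ.* g (j ∸ j′)) b) c k)
        (Σ<-coeff ℚ-ring (suc j) (λ j′ → (f j′ ZZ.* g (j ∸ j′)) b c) k)))
    (Q.Σ<-cong (suc j) (λ j′ → ≡.trans
      (≡.trans (conv-coeff ℚ[[q]] (f j′) (g (j ∸ j′)) b c k)
        (Σ<-coeff ℚ-ring (suc b) (λ b′ → (f j′ b′ Z.* g (j ∸ j′) (b ∸ b′)) c) k))
      (Q.Σ<-cong (suc b) (λ b′ → ≡.trans
        (conv-coeff ℚ-ring (f j′ b′) (g (j ∸ j′) (b ∸ b′)) c k)
        (Q.Σ<-cong (suc c) (λ c′ → Q.conv-Σ< (f j′ b′ c′) (g (j ∸ j′) (b ∸ b′) (c ∸ c′)) k))))))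

  reorder-⊛ : ∀ f g → reorder (f ⊛ g) T.≈ (reorder f T.* reorder g)
  reorder-⊛ f g j b c k = begin
    (f ⊛ g) k j b c
      ≡⟨ Σ≤-cong k (λ k′ → Σ≤-cong j (λ j′ → Σ≤-cong b (λ b′ → Σ≤-Σ< c (term k′ j′ b′)))) ⟩
    Q.Σ< (suc k) (λ k′ → Q.Σ< (suc j) (λ j′ → Q.Σ< (suc b) (λ b′ → Q.Σ< (suc c) (λ c′ → term k′ j′ b′ c′))))
      ≡⟨ Q.Σ<-swap (suc k) (suc j) (λ k′ j′ → Q.Σ< (suc b) (λ b′ → Q.Σ< (suc c) (λ c′ → term k′ j′ b′ c′))) ⟩
    Q.Σ< (suc j) (λ j′ → Q.Σ< (suc k) (λ k′ → Q.Σ< (suc b) (λ b′ → Q.Σ< (suc c) (λ c′ → term k′ j′ b′ c′))))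
      ≡⟨ Q.Σ<-cong (suc j) (λ j′ → ≡.trans
           (Q.Σ<-swap (suc k) (suc b) (λ k′ b′ → Q.Σ< (suc c) (λ c′ → term k′ j′ b′ c′)))
           (Q.Σ<-cong (suc b) (λ b′ → Q.Σ<-swap (suc k) (suc c) (λ k′ c′ → term k′ j′ b′ c′)))) ⟩
    Q.Σ< (suc j) (λ j′ → Q.Σ< (suc b) (λ b′ → Q.Σ< (suc c) (λ c′ → Q.Σ< (suc k) (λ k′ → term k′ j′ b′ c′))))
      ≡⟨ T-coeff (reorder f) (reorder g) j b c k ⟨
    (reorder f T.* reorder g) j b c k ∎
    where
    open ≡.≡-Reasoning
    Σ≤-cong : ∀ n {u v} → (∀ i → u i ≡ v i) → Σ≤ n u ≡ Q.Σ< (suc n) v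
    Σ≤-cong n {u} e = ≡.trans (Σ≤-Σ< n u) (Q.Σ<-cong (suc n) e)
    term : ℕ → ℕ → ℕ → ℕ → ℚ
    term k′ j′ b′ c′ = f k′ j′ b′ c′ ℚ.* g (k ∸ k′) (j ∸ j′) (b ∸ b′) (c ∸ c′)

  -- Equality modulo q^M.
  Agree : ℕ → T.Carrier → T.Carrier → Set
  Agree M f g = ∀ j b c k → k < M → f j b c k ≡ g j b c k

  agree-* : ∀ {M f f′ g g′} → Agree M f f′ → Agree M g g′ → Agree M (f T.* g) (f′ T.* g′)
  agree-* {M} {f} {f′} {g} {g′} p r j b c k k<M = ≡.trans (T-coeff f g j b c k) (≡.trans
    (Q.Σ<-cong (suc j) (λ j′ → Q.Σ<-cong (suc b) (λ b′ → Q.Σ<-cong (suc c) (λ c′ → Q.Σ<-cong< (suc k) (λ { k′ (s≤s k′≤k) →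
      ≡.cong₂ ℚ._*_ (p j′ b′ c′ k′ (ℕ.≤-<-trans k′≤k k<M))
        (r (j ∸ j′) (b ∸ b′) (c ∸ c′) (k ∸ k′) (ℕ.≤-<-trans (ℕ.m∸n≤m k k′) k<M)) })))))
    (≡.sym (T-coeff f′ g′ j b c k)))

  private
    *0* : ∀ a x → a ℚ.* (0ℚ ℚ.* x) ≡ 0ℚ
    *0* a x = ≡.trans (≡.cong (a ℚ.*_) (ℚ.*-zeroˡ x)) (ℚ.*-zeroʳ a)

    *1*0* : ∀ a x → a ℚ.* (1ℚ ℚ.* (0ℚ ℚ.* x)) ≡ 0ℚ
    *1*0* a x = ≡.trans (≡.cong (a ℚ.*_) (*0* 1ℚ x)) (ℚ.*-zeroʳ a)

    *1*x*0 : ∀ a x → a ℚ.* (1ℚ ℚ.* (x ℚ.* 0ℚ)) ≡ 0ℚ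
    *1*x*0 a x = ≡.trans (≡.cong (λ y → a ℚ.* (1ℚ ℚ.* y)) (ℚ.*-comm x 0ℚ)) (*1*0* a x)

    δ-suc : ∀ m n → δ (suc m) (suc n) ≡ δ m n
    δ-suc zero    zero    = ≡.refl
    δ-suc zero    (suc n) = ≡.refl
    δ-suc (suc m) zero    = ≡.refl
    δ-suc (suc m) (suc n) = ≡.refl

    q^-coeff : ∀ n k → (qVar ^ n) k ≡ δ k n
    q^-coeff zero    zero    = ≡.refl
    q^-coeff zero    (suc k) = ≡.refl
    q^-coeff (suc n) zero    = ℚ.*-zeroˡ ((qVar ^ n) 0)
    q^-coeff (suc n) (suc k) = ≡.trans (q-suc (qVar ^ n) k) (≡.trans (q^-coeff n k) (≡.sym (δ-suc k n)))

    exponential-1 : ∀ b k → exponential 1# b k ≡ δ k 0 ℚ.* inv! b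
    exponential-1 b k = ≡.trans (*-congʳ {ι (inv! b)} (1^ b) k)
      (≡.trans (*-identityˡ (ι (inv! b)) k) (constant k))
      where
      constant : ∀ k → Q.const (inv! b) k ≡ δ k 0 ℚ.* inv! b
      constant zero    = ≡.sym (ℚ.*-identityˡ (inv! b))
      constant (suc k) = ≡.sym (ℚ.*-zeroˡ (inv! b))

  reorder-qPow : ∀ n → reorder (qPow n) T.≈ ZZ.const (Q^ n)
  reorder-qPow n zero    zero    zero    k = ≡.trans (ℚ.*-identityʳ (δ k n)) (≡.sym (q^-coeff n k))
  reorder-qPow n zero    zero    (suc c) k = *1*x*0 (δ k n) 1ℚ
  reorder-qPow n zero    (suc b) c       k = *1*0* (δ k n) (δ c 0)
  reorder-qPow n (suc j) b       c       k = *0* (δ k n) (δ b 0 ℚ.* δ c 0)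

  reorder-one : reorder oneS T.≈ T.1#
  reorder-one = reorder-qPow 0

  reorder-tVar : reorder tVar T.≈ monomial 1 ZZ.1#
  reorder-tVar zero          b       c       k = *0* (δ k 0) (δ b 0 ℚ.* δ c 0)
  reorder-tVar (suc zero)    zero    zero    k = ≡.trans (ℚ.*-identityʳ (δ k 0)) (δ-0 k)
  reorder-tVar (suc zero)    zero    (suc c) k = *1*x*0 (δ k 0) 1ℚ
  reorder-tVar (suc zero)    (suc b) c       k = *1*0* (δ k 0) (δ c 0)
  reorder-tVar (suc (suc j)) b       c       k = *0* (δ k 0) (δ b 0 ℚ.* δ c 0)

  reorder-expZ₁ : reorder expZ₁ T.≈ ZZ.const x₁
  reorder-expZ₁ zero    b zero    k = ≡.trans
    (≡.cong (δ k 0 ℚ.*_) (≡.trans (ℚ.*-identityˡ _) (ℚ.*-identityʳ (inv! b)))) (≡.sym (exponential-1 b k))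
  reorder-expZ₁ zero    b (suc c) k = *1*x*0 (δ k 0) (inv! b)
  reorder-expZ₁ (suc j) b c       k = *0* (δ k 0) (inv! b ℚ.* δ c 0)

  reorder-expZ₂ : reorder expZ₂ T.≈ ZZ.const x₂
  reorder-expZ₂ zero    zero    c k = ≡.trans
    (≡.cong (δ k 0 ℚ.*_) (≡.trans (ℚ.*-identityˡ _) (ℚ.*-identityˡ (inv! c)))) (≡.sym (exponential-1 c k))
  reorder-expZ₂ zero    (suc b) c k = *1*0* (δ k 0) (inv! c)
  reorder-expZ₂ (suc j) b       c k = *0* (δ k 0) (δ b 0 ℚ.* inv! c)

  reorder-⊛tVar : ∀ {f x} → reorder f T.≈ ZZ.const x → reorder (f ⊛ tVar) T.≈ monomial 1 x
  reorder-⊛tVar {f} {x} e = T.trans (reorder-⊛ f tVar) (T.trans (T.*-cong e reorder-tVar)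
    (T.trans (conv-monomial 0 x ZZ.1#) (monomial-cong 1 (ZZ.*-identityʳ x))))

  reorder-⊛qPow : ∀ {f x} n → reorder f T.≈ monomial 1 x → reorder (f ⊛ qPow n) T.≈ monomial 1 (x ZZ.* Q^ n)
  reorder-⊛qPow {f} {x} n e = T.trans (reorder-⊛ f (qPow n)) (T.trans (T.*-cong e (reorder-qPow n))
    (T.trans (T.*-comm (monomial 1 x) (ZZ.const (Q^ n)))
      (λ d → ZZ.trans (ZZ.conv-const (Q^ n) (monomial 1 x) d)
        (ZZ.trans (*-monomial (Q^ n) 1 x d) (monomial-cong 1 (ZZ.*-comm (Q^ n) x) d)))))

  reorder-binomial : ∀ {f x} n → reorder f T.≈ monomial 1 x →
    reorder (oneS ⊖ f ⊛ qPow n) T.≈ binomial (ZZ.- (x ZZ.* Q^ n))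
  reorder-binomial {f} {x} n e =
    T.trans (T.+-cong reorder-one (T.-‿cong (reorder-⊛qPow n e))) (binomial-monomial (x ZZ.* Q^ n))

  reorder-powS : ∀ {s r} → reorder s T.≈ monomial 1 r → ∀ j → reorder (powS s j) T.≈ monomial j (r ^ᶻᶻ j)
  reorder-powS {s} {r} e zero    = reorder-one
  reorder-powS {s} {r} e (suc j) = T.trans (reorder-⊛ (powS s j) s) (T.trans (T.*-cong (reorder-powS e j) e)
    (T.trans (conv-monomial j (r ^ᶻᶻ j) r) (monomial-cong (suc j) (ZZ.*-comm (r ^ᶻᶻ j) r))))

  -- As `s` is homogeneous of degree 1 in t, the coefficient of t^j comes from the j-th power of `s`
  -- alone, and the cut-off k + j + b + c in `geomS` is at least j.
  reorder-geometric : ∀ {s r} → reorder s T.≈ monomial 1 r → reorder (geomS s) T.≈ geometric r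
  reorder-geometric {s} {r} e j b c k = begin
    Σ≤ N (λ i → powS s i k j b c)        ≡⟨ Σ≤-Σ< N (λ i → powS s i k j b c) ⟩
    Q.Σ< (suc N) (λ i → powS s i k j b c) ≡⟨ Q.Σ<-cong (suc N) (λ i → reorder-powS {s} {r} e i j b c k) ⟩
    Q.Σ< (suc N) (λ i → monomial i (r ^ᶻᶻ i) j b c k)
      ≡⟨ ≡.trans (Σ<-coeff (Series ℚ[[q]]) (suc N) (λ i → monomial i (r ^ᶻᶻ i) j) b c k)
           (≡.trans (Σ<-coeff ℚ[[q]] (suc N) (λ i → monomial i (r ^ᶻᶻ i) j b) c k)
             (Σ<-coeff ℚ-ring (suc N) (λ i → monomial i (r ^ᶻᶻ i) j b c) k)) ⟨
    ZZ.Σ< (suc N) (λ i → monomial i (r ^ᶻᶻ i) j) b c k ≡⟨ Σ<-monomial (r ^ᶻᶻ_) (s≤s j≤N) b c k ⟩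
    geometric r j b c k ∎
    where
    open ≡.≡-Reasoning
    N = k ℕ.+ j ℕ.+ b ℕ.+ c
    j≤N : j ≤ N
    j≤N = ℕ.≤-trans (ℕ.m≤n+m j k) (ℕ.≤-trans (ℕ.m≤m+n (k ℕ.+ j) b) (ℕ.m≤m+n (k ℕ.+ j ℕ.+ b) c))

  Q^-vanish : ∀ n {f h} → f ZZ.≈ (Q^ n ZZ.* h) → ∀ b c k → k < n → f b c k ≡ 0ℚ
  Q^-vanish n {h = h} e b c k k<n = ≡.trans (e b c k) (≡.trans (scalar-* (qVar ^ n) h b c k) (q^-< n (h b c) k<n))

  agree-binomial : ∀ x n → Agree n (binomial (ZZ.- (x ZZ.* Q^ n))) T.1#
  agree-binomial x n zero          b c k k<n = ≡.refl
  agree-binomial x n (suc zero)    b c k k<n =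
    ≡.cong ℚ.-_ (Q^-vanish n {h = x} (ZZ.*-comm x (Q^ n)) b c k k<n)
  agree-binomial x n (suc (suc d)) b c k k<n = ≡.refl

  agree-geometric : ∀ x n → Agree n (geometric (x ZZ.* Q^ n)) T.1#
  agree-geometric x n zero    b c k k<n = ≡.refl
  agree-geometric x n (suc d) b c k k<n = Q^-vanish n {h = x ZZ.* r^d}
    (ZZ.trans (ZZ.*-congʳ {r^d} (ZZ.*-comm x (Q^ n))) (ZZ.*-assoc (Q^ n) x r^d)) b c k k<n
    where r^d = (x ZZ.* Q^ n) ^ᶻᶻ d

  module _ (g : ℕ → PS) (tame : ∀ n → Agree n (reorder (g n)) T.1#) where

    prodTo-stable : ∀ {k N} → k ℕ.≤′ N → ∀ j b c → prodTo g N k j b c ≡ prodTo g k k j b c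
    prodTo-stable ℕ.≤′-refl j b c = ≡.refl
    prodTo-stable {k} (ℕ.≤′-step {N} k≤N) j b c = ≡.trans
      (reorder-⊛ (prodTo g N) (g (suc N)) j b c k)
      (≡.trans (agree-* {f = reorder (prodTo g N)} (λ _ _ _ _ _ → ≡.refl) (tame (suc N)) j b c k (s≤s (ℕ.≤′⇒≤ k≤N)))
        (≡.trans (T.*-identityʳ (reorder (prodTo g N)) j b c k) (prodTo-stable k≤N j b c)))

    infProd-prodTo : ∀ N → Agree (suc N) (reorder (infProd g)) (reorder (prodTo g N))
    infProd-prodTo N j b c k (s≤s k≤N) = ≡.sym (prodTo-stable (ℕ.≤⇒≤′ k≤N) j b c)

  agree-≈ : ∀ {M f f′ g} → f T.≈ f′ → Agree M f′ g → Agree M f g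
  agree-≈ e p j b c k k<M = ≡.trans (e j b c k) (p j b c k k<M)

  private
    g₁ g₂ g₃ g₄ : ℕ → PS
    g₁ n = oneS ⊖ expZ₁ ⊛ expZ₂ ⊛ tVar ⊛ qPow n
    g₂ n = oneS ⊖ tVar ⊛ qPow n
    g₃ n = geomS (expZ₁ ⊛ tVar ⊛ qPow n)
    g₄ n = geomS (expZ₂ ⊛ tVar ⊛ qPow n)

    x₁₂ : ZZ.Carrier
    x₁₂ = x₁ ZZ.* x₂

    reorder-expZ₁₂ : reorder (expZ₁ ⊛ expZ₂) T.≈ ZZ.const x₁₂
    reorder-expZ₁₂ = T.trans (reorder-⊛ expZ₁ expZ₂) (T.trans (T.*-cong reorder-expZ₁ reorder-expZ₂)
      (λ d → ZZ.trans (ZZ.conv-const x₁ (ZZ.const x₂) d) (*-monomial x₁ 0 x₂ d)))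

    e₁ : ∀ n → reorder (g₁ n) T.≈ binomial (ZZ.- (x₁₂ ZZ.* Q^ n))
    e₁ n = reorder-binomial n (reorder-⊛tVar {expZ₁ ⊛ expZ₂} {x₁₂} reorder-expZ₁₂)

    e₂ : ∀ n → reorder (g₂ n) T.≈ binomial (ZZ.- (ZZ.1# ZZ.* Q^ n))
    e₂ n = reorder-binomial {tVar} {ZZ.1#} n reorder-tVar

    e₃ : ∀ n → reorder (g₃ n) T.≈ geometric (x₁ ZZ.* Q^ n)
    e₃ n = reorder-geometric {expZ₁ ⊛ tVar ⊛ qPow n} {x₁ ZZ.* Q^ n}
      (reorder-⊛qPow {expZ₁ ⊛ tVar} {x₁} n (reorder-⊛tVar {expZ₁} {x₁} reorder-expZ₁))

    e₄ : ∀ n → reorder (g₄ n) T.≈ geometric (x₂ ZZ.* Q^ n)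
    e₄ n = reorder-geometric {expZ₂ ⊛ tVar ⊛ qPow n} {x₂ ZZ.* Q^ n}
      (reorder-⊛qPow {expZ₂ ⊛ tVar} {x₂} n (reorder-⊛tVar {expZ₂} {x₂} reorder-expZ₂))

    reorder-factor : ∀ n → (((reorder (g₁ n) T.* reorder (g₂ n)) T.* reorder (g₃ n)) T.* reorder (g₄ n)) T.≈ factor n
    reorder-factor n = T.trans (T.*-cong (T.*-cong (T.*-cong (e₁ n) (e₂ n)) (e₃ n)) (e₄ n)) (factor-ratio n)

    reorder-partial : ∀ N →
      (((reorder (prodTo g₁ N) T.* reorder (prodTo g₂ N)) T.* reorder (prodTo g₃ N)) T.* reorder (prodTo g₄ N))
        T.≈ partial (suc N)
    reorder-partial zero    = T.trans (reorder-factor 0) (T.sym (T.*-identityˡ (factor 0)))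
    reorder-partial (suc N) = T.trans
      (T.*-cong (T.*-cong (T.*-cong
        (reorder-⊛ (prodTo g₁ N) (g₁ (suc N))) (reorder-⊛ (prodTo g₂ N) (g₂ (suc N))))
        (reorder-⊛ (prodTo g₃ N) (g₃ (suc N)))) (reorder-⊛ (prodTo g₄ N) (g₄ (suc N))))
      (T.trans (interchange₄ (r g₁) (r g₂) (r g₃) (r g₄) _ _ _ _)
        (T.*-cong (reorder-partial N) (reorder-factor (suc N))))
      where
      r : (ℕ → PS) → T.Carrier
      r g = reorder (prodTo g N)

  -- Modulo q^N the four infinite products may all be cut off at the same index. The resulting
  -- finite product then regroups factor by factor with `interchange₄`.
  Fser-partial : ∀ {k N} → k < N → ∀ j b c → Fser k j b c ≡ partial N j b c k
  Fser-partial {k} {suc N} k<N j b c = ≡.trans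
    (T.trans (reorder-⊛ _ (infProd g₄)) (T.*-congʳ (T.trans (reorder-⊛ _ (infProd g₃))
      (T.*-congʳ (reorder-⊛ (infProd g₁) (infProd g₂))))) j b c k)
    (≡.trans
      (agree-* {f = (reorder (infProd g₁) T.* reorder (infProd g₂)) T.* reorder (infProd g₃)}
        (agree-* {f = reorder (infProd g₁) T.* reorder (infProd g₂)}
          (agree-* {f = reorder (infProd g₁)}
            (infProd-prodTo g₁ (λ n → agree-≈ (e₁ n) (agree-binomial x₁₂ n)) N)
            (infProd-prodTo g₂ (λ n → agree-≈ (e₂ n) (agree-binomial ZZ.1# n)) N))
          (infProd-prodTo g₃ (λ n → agree-≈ (e₃ n) (agree-geometric x₁ n)) N))
        (infProd-prodTo g₄ (λ n → agree-≈ (e₄ n) (agree-geometric x₂ n)) N)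
        j b c k k<N)
      (reorder-partial N j b c k))

  -- The coefficient of y⁰.

  layer-vanish : ∀ ρ e n → ρ n ≡ qVar ^ e → ∀ α h j {k} → k < e → layer ρ α h n j k ≡ 0ℚ
  layer-vanish ρ e n ρ≡ α h j {k} k<e = ≡.trans (layer-divisible ρ α h n j k)
    (≡.trans (≡.cong (λ r → (r * conv⁺ (λ d → nat (suc d) ^ α * ρ n ^ d) (h n) j) k) ρ≡) (q^-< e _ k<e))

  conv-agree : ∀ (x a b : ℕ → ℚ) n K → (∀ k → k < n → x k ≡ 0ℚ) → (∀ k → k ≤ K ∸ n → a k ≡ b k) →
               (x * a) K ≡ (x * b) K
  conv-agree x a b n K x0 e = ≡.trans (Q.conv-Σ< x a K)
    (≡.trans (Q.Σ<-cong (suc K) same) (≡.sym (Q.conv-Σ< x b K)))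
    where
    same : ∀ i → x i ℚ.* a (K ∸ i) ≡ x i ℚ.* b (K ∸ i)
    same i with i ℕ.<? n
    ... | yes i<n = ≡.trans (≡.cong (ℚ._* a (K ∸ i)) (x0 i i<n))
      (≡.trans (ℚ.*-zeroˡ (a (K ∸ i))) (≡.sym (≡.trans (≡.cong (ℚ._* b (K ∸ i)) (x0 i i<n)) (ℚ.*-zeroˡ (b (K ∸ i))))))
    ... | no i≮n = ≡.cong (x i ℚ.*_) (e (K ∸ i) (ℕ.∸-monoʳ-≤ K (ℕ.≮⇒≥ i≮n)))

  -- Modulo q^{K+1} only the pairs of levels with n + m < K contribute.
  truncated-product : ∀ (X Y : ℕ → ℕ → ℚ) K → (∀ n k → k < n → X n k ≡ 0ℚ) → (∀ m k → k ≤ m → Y m k ≡ 0ℚ) →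
    (Σ< (suc K) X * Σ< (suc K) Y) K ≡ Σ< K (conv X Y) K
  truncated-product X Y K X0 Y0 = ≡.trans (sym (Σ<-*ʳ (suc K) (Σ< (suc K) Y) X) K)
    (≡.trans (Σ<-coeff ℚ-ring (suc K) (λ n → X n * Σ< (suc K) Y) K)
    (≡.trans (Q.Σ<-cong (suc K) (λ n →
        -- `X n` starts at q^n, so the other sum matters up to q^(K-n) only; there `Y m`, which
        -- starts at q^(m+1), contributes for m < K - n only.
        conv-agree (X n) (Σ< (suc K) Y) (Σ< (K ∸ n) Y) n K (X0 n) (λ k k≤ → ≡.trans (Σ<-coeff ℚ-ring (suc K) Y k)
          (≡.trans (Q.Σ<-extend (λ m → Y m k) (ℕ.≤-trans (ℕ.m∸n≤m K n) (ℕ.n≤1+n K)) (λ m le → Y0 m k (ℕ.≤-trans k≤ le)))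
            (≡.sym (Σ<-coeff ℚ-ring (K ∸ n) Y k))))))
    (≡.trans (≡.sym (Σ<-coeff ℚ-ring (suc K) (λ n → X n * Σ< (K ∸ n) Y) K))
    (≡.trans (sym (conv-Σ< X (λ n → Σ< n Y) K) K) (conv-Σ<ʳ X Y K K)))))

  -- The value of `u` at `(K , j)` is trusted only at q^K, so the level bound K moves with the
  -- coefficient. For `pair`, the factor q^j makes j ≤ K sufficient. The argument of type `⊤` gives
  -- a single series the form that `Span` expects.
  diagonal : (ℕ × ℕ → Carrier) → ⊤ → Carrier
  diagonal u _ K = Q.Σ< (suc K) (λ j → u (K , j) K)

  ι-coeff : ∀ a f k → (ι a * f) k ≡ a ℚ.* f k
  ι-coeff a f k = Q.conv-const a f k

  diagonal-linear : Linear diagonal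
  diagonal-linear = record
    { T-cong = λ e _ K → Q.Σ<-cong (suc K) (λ j → e (K , j) K)
    ; T-+ = λ f g _ K → Q.Σ<-+ (suc K) (λ j → f (K , j) K) (λ j → g (K , j) K)
    ; T-* = λ a f _ K → ≡.trans (Q.Σ<-cong (suc K) (λ j → ι-coeff a (f (K , j)) K))
        (≡.trans (Q.Σ<-*ˡ (suc K) a (λ j → f (K , j) K)) (≡.sym (ι-coeff a (diagonal f tt) K)))
    }

  bracketSeries : BiIdx → ⊤ → Carrier
  bracketSeries L _ = bibracket L

  InSpan : ℕ → BiIdx → Set
  InSpan w L = ValidBi L × InQBD L × weight L ≤ w

  -- With u₁ ≤ K and v₁ + ⋯ + v_ℓ ≤ K no term of the coefficient of q^K is lost, so the whole
  -- bi-bracket appears, up to its factorials.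
  span-diagonal-top : ∀ w i → Admissible w 1 i → Span bracketSeries (InSpan w) (diagonal (cumulative (top i)))
  span-diagonal-top w ((s , r) , L) (1<s , valid , le) = span-cong
    (λ _ K → ≡.trans (brackets-bbCoeff ((s , r) ∷ L) K K (suc K) ℕ.≤-refl) (≡.sym (ι-coeff c (bibracket ((s , r) ∷ L)) K)))
    (span-* c (span-gen {i = (s , r) ∷ L} ((ℕ.<⇒≤ 1<s , valid) , 1<s , le)))
    where c = factorials ((s , r) ∷ L)

  -- Two empty chains meet at j = 0 and give the empty bi-bracket 1. An empty and a nonempty chain
  -- have different lengths and give 0. The remaining case is `span-product`, after the substitution
  -- `chain-τ` and the truncation to n + m < K.
  span-pair : ∀ {w₁ w₂} αs βs → Light w₁ αs → Light w₂ βs →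
    Span bracketSeries (InSpan (w₁ ℕ.+ w₂)) (diagonal (pair (chain₀ βs) (chain₀ αs)))
  span-pair [] [] _ _ = span-cong (λ _ K → ≡.trans (≡.cong₂ ℚ._+_
      (trans (*-identityʳ (1# * 1#)) (*-identityʳ 1#) K)
      (Q.Σ<-zero K (λ j _ → zeroʳ (qVar ^ suc j * 0#) K))) (≡.trans (ℚ.+-identityʳ _) (≡.sym (δ-0 K))))
    (span-gen {i = []} (tt , tt , z≤n))
  span-pair [] (β ∷ βs) _ _ = span-cong
    (λ _ → trans (Linear.T-cong diagonal-linear vanish tt) (Linear.T-0 diagonal-linear tt)) span-0
    where
    vanish : ∀ x → pair (chain₀ (β ∷ βs)) (chain₀ []) x ≈ 0#
    vanish (K , zero)  = trans (*-identityʳ _) (trans (*-congˡ {1#} (chain-0 ρ₀ β βs (suc K))) (zeroʳ 1#))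
    vanish (K , suc j) = zeroʳ _
  span-pair (α ∷ αs) [] _ _ = span-cong
    (λ _ → trans (Linear.T-cong diagonal-linear vanish tt) (Linear.T-0 diagonal-linear tt)) span-0
    where
    vanish : ∀ x → pair (chain₀ []) (chain₀ (α ∷ αs)) x ≈ 0#
    vanish (K , zero)  = trans (*-congˡ {1# * 1#} (chain-0 ρ₀ α αs (suc K))) (zeroʳ (1# * 1#))
    vanish (K , suc j) = trans (*-congʳ {chain₀ (α ∷ αs) (suc K , suc j)} (zeroʳ (qVar ^ suc j))) (zeroˡ (chain₀ (α ∷ αs) (suc K , suc j)))
  span-pair {w₁} {w₂} (α ∷ αs) (β ∷ βs) (1≤α ∷ _ , le₁) (1≤β ∷ _ , le₂) = span-cong
    (λ _ K → Q.Σ<-cong (suc K) (λ j → reduce K j))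
    (span-map (linear-∘ diagonal-linear cumulative-linear) (span-diagonal-top (w₁ ℕ.+ w₂))
      (span-mono (λ (l , v , le) → l , v , ℕ.≤-trans le (ℕ.+-mono-≤ le₁ le₂))
        -- The leading exponents are at least 1, so `μ = 1` is available here, and this yields s₁ >
        -- 1.
        (span-product ρ₀ τ ρ₀τ≈τ α αs β βs 1≤α 1≤β)))
    where
    reduce : ∀ K j → pair (chain₀ (β ∷ βs)) (chain₀ (α ∷ αs)) (K , j) K ≡
      cumulative (product ρ₀ τ ρ₀τ≈τ α αs β βs) (K , j) K
    reduce K j = ≡.trans
      (trans (*-congʳ {chain₀ (α ∷ αs) (suc K , j)} (chain-τ (β ∷ βs) (suc K) j))
        (*-comm (chain τ (β ∷ βs) (suc K) j) (chain₀ (α ∷ αs) (suc K , j))) K)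
      (truncated-product (λ n → layer ρ₀ α (chain ρ₀ αs) n j) (λ m → layer τ β (chain τ βs) m j) K
        (λ n k → layer-vanish ρ₀ n n ≡.refl α (chain ρ₀ αs) j)
        (λ m k k≤m → layer-vanish τ (suc m) m ≡.refl β (chain τ βs) j (s≤s k≤m)))

  -- The factor q^j moves the convolution in q from K to K - j. All indices that occur are at most
  -- K, where the truncation at K + 1 agrees with `F`.
  hadamard-diagonal : ∀ (F : PS) (p : ℕ → T.Carrier) →
    (∀ {k N} → k < N → ∀ j b c → F k j b c ≡ p N j b c k) → ∀ m n m′ n′ K →
    Σ≤ K (λ j → Σ≤ (K ∸ j) (λ k → F k j m n ℚ.* F (K ∸ j ∸ k) j m′ n′)) ≡
    diagonal (pair (λ (N , j) → p N j m′ n′) (λ (N , j) → p N j m n)) tt K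
  hadamard-diagonal F p F≡p m n m′ n′ K =
    ≡.trans (Σ≤-Σ< K (λ j → Σ≤ (K ∸ j) (λ k → F k j m n ℚ.* F (K ∸ j ∸ k) j m′ n′)))
      (Q.Σ<-cong< (suc K) (λ { j (s≤s j≤K) → term j j≤K }))
    where
    term : ∀ j → j ≤ K → Σ≤ (K ∸ j) (λ k → F k j m n ℚ.* F (K ∸ j ∸ k) j m′ n′) ≡
      (qVar ^ j * p (suc K) j m′ n′ * p (suc K) j m n) K
    term j j≤K = ≡.trans (Σ≤-Σ< (K ∸ j) (λ k → F k j m n ℚ.* F (K ∸ j ∸ k) j m′ n′))
      (≡.trans (Q.Σ<-cong< (suc (K ∸ j)) (λ { k (s≤s k≤) → ≡.cong₂ ℚ._*_
          (F≡p (s≤s (ℕ.≤-trans k≤ (ℕ.m∸n≤m K j))) j m n)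
          (F≡p (s≤s (ℕ.≤-trans (ℕ.m∸n≤m (K ∸ j) k) (ℕ.m∸n≤m K j))) j m′ n′) }))
      (≡.trans (≡.sym (Q.conv-Σ< P P′ (K ∸ j)))
      (≡.trans (≡.sym (q^-≥ j (P * P′) j≤K))
        (rotate (qVar ^ j) P P′ K))))
      where
      P P′ : Carrier
      P = p (suc K) j m n
      P′ = p (suc K) j m′ n′

  coeffY0-diagonal : ∀ m n m′ n′ K → coeffY0 K m n m′ n′ ≡
    diagonal (pair (λ (N , j) → partial N j m′ n′) (λ (N , j) → partial N j m n)) tt K
  coeffY0-diagonal = hadamard-diagonal Fser partial Fser-partial

  linComb-combination : ∀ cs K → linComb cs K ≡ combination bracketSeries cs tt K
  linComb-combination []             K = ≡.refl
  linComb-combination ((c , L) ∷ cs) K = ≡.cong₂ ℚ._+_ (≡.sym (ι-coeff c (bibracket L) K)) (linComb-combination cs K)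

  -- `pair` is bilinear but `pair-linear` covers only its second argument; the two factors are
  -- expanded one after the other, with `pair-comm` exchanging them.
  span-coeffY0 : ∀ m n m′ n′ → Span bracketSeries (InSpan (m ℕ.+ n ℕ.+ (m′ ℕ.+ n′)))
    (diagonal (pair (λ (N , j) → partial N j m′ n′) (λ (N , j) → partial N j m n)))
  span-coeffY0 m n m′ n′ = span-map
    (linear-∘ diagonal-linear (pair-linear (λ (N , j) → partial N j m′ n′)))
    (λ αs light → span-cong (Linear.T-cong diagonal-linear (pair-comm (λ (N , j) → partial N j m′ n′) (chain₀ αs)))
      (span-map (linear-∘ diagonal-linear (pair-linear (chain₀ αs)))
        (λ βs light′ → span-cong (Linear.T-cong diagonal-linear (pair-comm (chain₀ αs) (chain₀ βs)))
          (span-pair αs βs light light′))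
        (span-partial (suc (m′ ℕ.+ n′)) m′ n′ ℕ.≤-refl)))
    (span-partial (suc (m ℕ.+ n)) m n ℕ.≤-refl)

  span⇒linComb : ∀ {w w′ f} (c : ℕ → ℚ) → w ≤ w′ → (∀ K → c K ≡ f tt K) → Span bracketSeries (InSpan w) f →
    Σ (List (ℚ × BiIdx)) λ cs → All (InSpan w′ ∘ proj₂) cs × (∀ K → c K ≡ linComb cs K)
  span⇒linComb c w≤w′ c≡f (cs , admissible , eq) = cs
    , All.map (λ (v , i , w) → v , i , ℕ.≤-trans w w≤w′) admissible
    , λ K → ≡.trans (c≡f K) (≡.trans (eq tt K) (≡.sym (linComb-combination cs K)))

open import Data.Nat using (_+_)

theorem4p6 : (m n m' n' : ℕ) →
    Σ (List (ℚ × BiIdx)) λ cs →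
    All (λ p → ValidBi (proj₂ p) × InQBD (proj₂ p)
    × weight (proj₂ p) ≤ m + n + m' + n') cs
    × ((K : ℕ) → coeffY0 K m n m' n' ≡ linComb cs K)
theorem4p6 m n m' n' = span⇒linComb (λ K → coeffY0 K m n m' n')
  (ℕ.≤-reflexive (≡.sym (ℕ.+-assoc (m + n) m' n')))
  (coeffY0-diagonal m n m' n') (span-coeffY0 m n m' n')
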